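{- Let $s\geq 2$, $r\geq 1$ and $n\geq 3r^2(s-1)$ be integers. If $\mathcal{H}$ is an $r$-uniform hypergraph on $n$ vertices with $\sigma_r(\mathcal{H})>r\left(\binom{n-1}{r-1}-\binom{n-s}{r-1}\right)$, then $\mathcal{H}$ contains $s$ pairwise disjoint edges.
   Context: An $r$-uniform hypergraph on vertex set $V$ with $|V|=n$ is a family of $r$-subsets of $V$ (its edges). The degree $\deg(v)$ of a vertex is the number of edges containing it; for an $r$-set $S$, $\deg(S)=\sum_{v\in S}\deg(v)$. The Ore-degree $\sigma_r(\mathcal{H})$ is the minimum of $\deg(S)$ over all $r$-subsets $S\subseteq V$ that are not edges of $\mathcal{H}$. -}

module Defs where

open import Data.Nat using (ℕ; _+_)
open import Data.Fin using (Fin)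
open import Data.Fin.Subset using (Subset; ∣_∣; _∈_; _∩_; ⊥)
open import Data.Fin.Subset.Properties using (_∈?_)
open import Data.List using (List; length; filter; map; allFin)
open import Data.Nat.ListAction using (sum)
open import Data.Nat using (_<_)
open import Data.Product using (Σ; _×_)
open import Relation.Nullary using (¬_)
open import Data.List.Relation.Unary.All using (All)
open import Data.List.Relation.Unary.AllPairs using (AllPairs)
open import Data.List.Relation.Unary.Unique.Propositional using (Unique)
open import Data.List.Membership.Propositional renaming (_∈_ to _∈ₗ_)
open import Relation.Binary.PropositionalEquality using (_≡_)

record Hypergraph (n r : ℕ) : Set where
  field
    edges    : List (Subset n)
    uniform  : All (λ e → ∣ e ∣ ≡ r) edges
    distinct : Unique edges
open Hypergraph public

deg : ∀ {n r} → Hypergraph n r → Fin n → ℕ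
deg H v = length (filter (v ∈?_) (edges H))

degSet : ∀ {n r} → Hypergraph n r → Subset n → ℕ
degSet {n} H S = sum (map (deg H) (filter (_∈? S) (allFin n)))

-- σ_r(H) > b : every r-subset S that is not an edge has deg(S) > b
-- (vacuous when every r-subset is an edge, i.e. σ_r = min ∅ = ∞).
OreDegreeGreaterThan : ∀ {n r} → Hypergraph n r → ℕ → Set
OreDegreeGreaterThan {n} {r} H b =
  (S : Subset n) → ∣ S ∣ ≡ r → ¬ (S ∈ₗ edges H) → b < degSet H S

HasMatching : ∀ {n r} → Hypergraph n r → ℕ → Set
HasMatching {n} H s =
  Σ (List (Subset n)) λ M →
    (length M ≡ s) × All (_∈ₗ edges H) M × AllPairs (λ e f → e ∩ f ≡ ⊥) M

{-# OPTIONS --safe #-}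
module Submission where

-- Let r = k + 1, s = p + 1 and Y = C(n-1, r-2), an upper bound for the codegrees.
-- If some vertex has degree > r p Y, delete it: the Ore condition survives with s - 1, and some edge
-- through the vertex avoids the matching of size s - 1 found by induction. Otherwise, take a maximal
-- matching; if it has at most p edges, its vertex set U covers all edges and |U| ≤ r p.
-- If s vertices of U have degree > 2 p Y, then the edges through each of them that avoid the other
-- ones leave links of size > p Y, and the Huang–Loh–Sudakov lemma (rainbow) gives s disjoint edges.
-- Otherwise e(H) ≤ Σ_{u∈U} deg u ≤ 3 r p² Y. The r-sets outside U are non-edges, so by the Ore condition
-- disjoint ones outside U contribute p (3r - 1) blocks of large degree sum, whereas the degrees
-- outside U add up to at most (r - 1) e(H); for n ≥ 3 r² p this is a contradiction.

open import Defs
open import Data.Nat using (ℕ; _≤_; _*_; _∸_; _^_)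
open import Data.Nat.Combinatorics using (_C_)

open import Data.Bool using (Bool; true; false; _∧_; _∨_; not; if_then_else_)
open import Data.Bool.Properties using (∧-conicalˡ; ∧-conicalʳ; ∧-zeroʳ; ¬-not) renaming (_≟_ to _≟ᵇ_)
open import Data.Empty using (⊥-elim)
open import Data.Fin using (Fin; zero; suc; punchIn; punchOut)
open import Data.Fin.Properties using (punchInᵢ≢i; punchIn-punchOut; any?)
  renaming (_≟_ to _≟ᶠ_; suc-injective to suc-injectiveᶠ)
open import Data.Fin.Subset using (Subset; ∣_∣; _∪_; _∩_; ∁; ⊥; ⊤; ⁅_⁆)
open import Data.Fin.Subset.Properties using (∣⁅x⁆∣≡1; x∈⁅x⁆; ∣⊥∣≡0; ∣⊤∣≡n; ∣∁p∣≡n∸∣p∣; _∈?_)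
open import Data.List as List using (List; []; _∷_; allFin; map; filter; length)
import Data.List.Membership.DecPropositional as DecMembership
open import Data.List.Membership.Propositional using () renaming (_∈_ to _∈ₗ_)
open import Data.List.Membership.Propositional.Properties using (∈-allFin)
open import Data.List.Properties using (length-tabulate; map-tabulate)
open import Data.List.Relation.Unary.All as All using (All; []; _∷_)
import Data.List.Relation.Unary.All.Properties as All
open import Data.List.Relation.Unary.AllPairs using ([]; _∷_)
import Data.List.Relation.Unary.AllPairs.Properties as AllPairs
open import Data.List.Relation.Unary.Any using (here; there)
open import Data.List.Relation.Unary.Unique.Propositional using (Unique)
open import Data.Nat.ListAction using () renaming (sum to sumₗ)
open import Data.Nat using (zero; suc; _+_; _<_; z≤n; s≤s; _!; _≤?_; _<?_; NonZero; ≢-nonZero; s≤s⁻¹)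
open import Data.Nat.Combinatorics using (nCk+nC[k+1]≡[n+1]C[k+1]; [n-k]*[n-k-1]!≡[n-k]!)
open import Data.Nat.Properties
open import Data.Nat.Tactic.RingSolver using (solve-∀)
open import Data.Product using (∃; _×_; _,_; proj₁; proj₂)
open import Data.Sum using (_⊎_; inj₁; inj₂)
open import Data.Vec using ([]; _∷_; lookup; insertAt; _[_]≔_)
open import Data.Vec.Properties
  using (insertAt-lookup; insertAt-punchIn; []≔-lookup; lookup∘update; lookup∘update′; ≡-dec; []=⇒lookup;
         lookup-zipWith; lookup-replicate)
open import Function using (_∘_; case_of_)
open import Relation.Nullary using (¬_; Dec; yes; no; contradiction; _×-dec_)
open import Relation.Binary.PropositionalEquality
  using (_≡_; _≢_; refl; sym; trans; cong; cong₂; subst; module ≡-Reasoning)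

open import Algebra.Properties.Semiring.Sum +-*-semiring
  using (sum; sum-cong-≗; ∑-distrib-+; *-distribˡ-sum; *-distribʳ-sum)
open import Algebra.Properties.CommutativeSemigroup +-commutativeSemigroup using (x∙yz≈y∙xz; interchange)
open import Algebra.Properties.CommutativeSemigroup *-commutativeSemigroup using ()
  renaming (x∙yz≈y∙xz to *-x∙yz≈y∙xz)

-- A greedy choice of s disjoint edges through s vertices of U would need degrees of order r p Y.
-- The light vertices of U could then carry about r² p² Y edges, too many for large r. The rainbow
-- lemma lowers the bar to 2 p Y: p Y pays for the edges through the other chosen vertices, and p Y
-- is what the lemma itself asks for. Deletion supplies the bound r p Y for the fewer than s heavy
-- vertices, so there are at most p · r p Y + r p · 2 p Y = 3 r p² Y edges. The 3 returns in n ≥ 3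
-- r² p: at least 3 r² p - r p = r · p (3r - 1) vertices lie outside U. If C(n-1, r-1) - C(n-s, r-1)
-- were p Y, the blocks would give p (3r - 1) · r p Y from below, against (r - 1) · 3 r p² Y from
-- above. The true difference is smaller than p Y in general, and the ratio of 3r - 1 to 3r - 3
-- absorbs the loss once n ≥ 3 r² p.

private variable
  m n k t : ℕ

⟦_⟧ : Bool → ℕ
⟦ true ⟧  = 1
⟦ false ⟧ = 0

⟦_⟧≤1 : ∀ b → ⟦ b ⟧ ≤ 1
⟦ true ⟧≤1  = ≤-refl
⟦ false ⟧≤1 = z≤n

⟦⟧>0⇒true : ∀ {b} → 0 < ⟦ b ⟧ → b ≡ true
⟦⟧>0⇒true {true} _ = refl

true⇒⟦⟧≡1 : ∀ {b} → b ≡ true → ⟦ b ⟧ ≡ 1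
true⇒⟦⟧≡1 refl = refl

+-split-< : ∀ a {b c d} → a + b < c + d → a < c ⊎ b < d
+-split-< a {b} {c} {d} lt with a <? c | b <? d
... | yes p | _     = inj₁ p
... | no  _ | yes q = inj₂ q
... | no  p | no  q = contradiction lt (≤⇒≯ (+-mono-≤ (≮⇒≥ p) (≮⇒≥ q)))

-- Sums over the k-subsets of Fin n

-- Families of sets are Boolean predicates, and their sizes are sums of this kind. Recursion on the
-- first coordinate, as in Pascal's rule, turns counting into arithmetic without a list of all
-- k-subsets.
ssum : ∀ {n} → ℕ → (Subset n → ℕ) → ℕ
ssum {zero}  zero    f = f []
ssum {zero}  (suc k) f = 0
ssum {suc n} zero    f = ssum zero (f ∘ (false ∷_))
ssum {suc n} (suc k) f = ssum k (f ∘ (true ∷_)) + ssum (suc k) (f ∘ (false ∷_))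

ssum-mono : ∀ k {f g : Subset n → ℕ} → (∀ A → ∣ A ∣ ≡ k → f A ≤ g A) → ssum k f ≤ ssum k g
ssum-mono {zero}  zero    h = h [] refl
ssum-mono {zero}  (suc k) h = z≤n
ssum-mono {suc n} zero    h = ssum-mono zero (λ A → h (false ∷ A))
ssum-mono {suc n} (suc k) h =
  +-mono-≤ (ssum-mono k (λ A → h (true ∷ A) ∘ cong suc)) (ssum-mono (suc k) (λ A → h (false ∷ A)))

ssum-cong : ∀ k {f g : Subset n → ℕ} → (∀ A → ∣ A ∣ ≡ k → f A ≡ g A) → ssum k f ≡ ssum k g
ssum-cong k h =
  ≤-antisym (ssum-mono k (λ A → ≤-reflexive ∘ h A)) (ssum-mono k (λ A → ≤-reflexive ∘ sym ∘ h A))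

ssum-zero : ∀ n k → ssum {n} k (λ _ → 0) ≡ 0
ssum-zero zero    zero    = refl
ssum-zero zero    (suc k) = refl
ssum-zero (suc n) zero    = ssum-zero n zero
ssum-zero (suc n) (suc k) = cong₂ _+_ (ssum-zero n k) (ssum-zero n (suc k))

ssum-+ : ∀ k (f g : Subset n → ℕ) → ssum k (λ A → f A + g A) ≡ ssum k f + ssum k g
ssum-+ {zero}  zero    f g = refl
ssum-+ {zero}  (suc k) f g = refl
ssum-+ {suc n} zero    f g = ssum-+ zero (f ∘ (false ∷_)) (g ∘ (false ∷_))
ssum-+ {suc n} (suc k) f g =
  trans (cong₂ _+_ (ssum-+ k (f ∘ (true ∷_)) (g ∘ (true ∷_)))
                   (ssum-+ (suc k) (f ∘ (false ∷_)) (g ∘ (false ∷_))))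
        (interchange (ssum k (f ∘ (true ∷_))) _ _ _)

ssum-* : ∀ k c (f : Subset n → ℕ) → ssum k (λ A → c * f A) ≡ c * ssum k f
ssum-* {zero}  zero    c f = refl
ssum-* {zero}  (suc k) c f = sym (*-zeroʳ c)
ssum-* {suc n} zero    c f = ssum-* zero c (f ∘ (false ∷_))
ssum-* {suc n} (suc k) c f =
  trans (cong₂ _+_ (ssum-* k c (f ∘ (true ∷_))) (ssum-* (suc k) c (f ∘ (false ∷_))))
        (sym (*-distribˡ-+ c _ _))

ssum-witness : ∀ k {f g : Subset n → ℕ} → ssum k f < ssum k g → ∃ λ A → ∣ A ∣ ≡ k × f A < g A
ssum-witness {zero}  zero    lt = [] , refl , lt
ssum-witness {suc n} zero    lt =
  let A , eq , lt′ = ssum-witness zero lt in false ∷ A , eq , lt′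
ssum-witness {suc n} (suc k) {f} lt with +-split-< (ssum k (f ∘ (true ∷_))) lt
... | inj₁ lt′ = let A , eq , lt″ = ssum-witness k lt′ in true ∷ A , cong suc eq , lt″
... | inj₂ lt′ = let A , eq , lt″ = ssum-witness (suc k) lt′ in false ∷ A , eq , lt″

ssum-member : ∀ k {P : Subset n → Bool} → 0 < ssum k (⟦_⟧ ∘ P) → ∃ λ A → ∣ A ∣ ≡ k × P A ≡ true
ssum-member {n} k {P} lt =
  let A , eq , lt′ = ssum-witness k {λ _ → 0} {⟦_⟧ ∘ P} (subst (_< ssum k (⟦_⟧ ∘ P)) (sym (ssum-zero n k)) lt)
  in A , eq , ⟦⟧>0⇒true lt′

ssum-zero-insertAt : ∀ {n} (v : Fin (suc n)) (f : Subset (suc n) → ℕ) →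
  ssum zero f ≡ ssum zero (λ B → f (insertAt B v false))
ssum-zero-insertAt zero f = refl
ssum-zero-insertAt {suc n} (suc v) f = ssum-zero-insertAt v (f ∘ (false ∷_))

-- The recursion of `ssum` splits at the point zero; this is the same split at an arbitrary point.
-- Links, vertex deletion and the reduction of shifts rest on it.
ssum-insertAt : ∀ k (v : Fin (suc n)) (f : Subset (suc n) → ℕ) →
  ssum (suc k) f ≡ ssum k (λ B → f (insertAt B v true)) + ssum (suc k) (λ B → f (insertAt B v false))
ssum-insertAt k zero f = refl
ssum-insertAt {suc n} zero (suc v) f = begin
  ssum zero f₁ + ssum 1 f₀
    ≡⟨ cong₂ _+_ (ssum-zero-insertAt v f₁) (ssum-insertAt zero v f₀) ⟩
  ssum zero (λ B → f₁ (insertAt B v false)) +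
    (ssum zero (λ B → f₀ (insertAt B v true)) + ssum 1 (λ B → f₀ (insertAt B v false)))
    ≡⟨ x∙yz≈y∙xz (ssum zero (λ B → f₁ (insertAt B v false))) (ssum zero (λ B → f₀ (insertAt B v true))) _ ⟩
  ssum zero (λ B → f₀ (insertAt B v true)) +
    (ssum zero (λ B → f₁ (insertAt B v false)) + ssum 1 (λ B → f₀ (insertAt B v false))) ∎
  where
  open ≡-Reasoning
  f₁ = f ∘ (true ∷_)
  f₀ = f ∘ (false ∷_)
ssum-insertAt {suc n} (suc k) (suc v) f = begin
  ssum (suc k) f₁ + ssum (suc (suc k)) f₀
    ≡⟨ cong₂ _+_ (ssum-insertAt k v f₁) (ssum-insertAt (suc k) v f₀) ⟩
  (ssum k (λ B → f₁ (insertAt B v true)) + ssum (suc k) (λ B → f₁ (insertAt B v false))) +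
    (ssum (suc k) (λ B → f₀ (insertAt B v true)) + ssum (suc (suc k)) (λ B → f₀ (insertAt B v false)))
    ≡⟨ interchange (ssum k (λ B → f₁ (insertAt B v true))) _ _ _ ⟩
  (ssum k (λ B → f₁ (insertAt B v true)) + ssum (suc k) (λ B → f₀ (insertAt B v true))) +
    (ssum (suc k) (λ B → f₁ (insertAt B v false)) + ssum (suc (suc k)) (λ B → f₀ (insertAt B v false))) ∎
  where
  open ≡-Reasoning
  f₁ = f ∘ (true ∷_)
  f₀ = f ∘ (false ∷_)

ssum-one : ∀ n k → ssum {n} k (λ _ → 1) ≡ n C k
ssum-one zero    zero    = refl
ssum-one zero    (suc k) = refl
ssum-one (suc n) zero    = ssum-one n zero
ssum-one (suc n) (suc k) =
  trans (cong₂ _+_ (ssum-one n k) (ssum-one n (suc k))) (nCk+nC[k+1]≡[n+1]C[k+1] n k)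

-- The number of k-subsets of Fin n containing a given point: C(n-1, k-1), and 0 when k = 0.
star : ℕ → ℕ → ℕ
star zero    k       = 0
star (suc n) zero    = 0
star (suc n) (suc k) = n C k

star-pascal : ∀ n k → star (suc (suc n)) (suc k) ≡ star (suc n) k + star (suc n) (suc k)
star-pascal n zero    = refl
star-pascal n (suc k) = sym (nCk+nC[k+1]≡[n+1]C[k+1] n k)

ssum-star : ∀ k (v : Fin n) → ssum k (λ A → ⟦ lookup A v ⟧) ≡ star n k
ssum-star {suc n}       zero    zero    = ssum-zero n zero
ssum-star {suc n}       (suc k) zero    =
  trans (cong₂ _+_ (ssum-one n k) (ssum-zero n (suc k))) (+-identityʳ _)
ssum-star {suc (suc n)} zero    (suc v) = ssum-star zero v
ssum-star {suc (suc n)} (suc k) (suc v) =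
  trans (cong₂ _+_ (ssum-star k v) (ssum-star (suc k) v)) (sym (star-pascal n k))

-- Sums over the elements of a subset

wsum : Subset n → (Fin n → ℕ) → ℕ
wsum []          w = 0
wsum (true ∷ A)  w = w zero + wsum A (w ∘ suc)
wsum (false ∷ A) w = wsum A (w ∘ suc)

wsum-mono : ∀ (A : Subset n) {w w′} → (∀ x → lookup A x ≡ true → w x ≤ w′ x) → wsum A w ≤ wsum A w′
wsum-mono []          h = z≤n
wsum-mono (true ∷ A)  h = +-mono-≤ (h zero refl) (wsum-mono A (h ∘ suc))
wsum-mono (false ∷ A) h = wsum-mono A (h ∘ suc)

wsum-cong : ∀ (A : Subset n) {w w′} → (∀ x → w x ≡ w′ x) → wsum A w ≡ wsum A w′
wsum-cong A h =
  ≤-antisym (wsum-mono A (λ x _ → ≤-reflexive (h x))) (wsum-mono A (λ x _ → ≤-reflexive (sym (h x))))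

wsum-+ : ∀ (A : Subset n) w w′ → wsum A (λ x → w x + w′ x) ≡ wsum A w + wsum A w′
wsum-+ []          w w′ = refl
wsum-+ (true ∷ A)  w w′ =
  trans (cong ((w zero + w′ zero) +_) (wsum-+ A (w ∘ suc) (w′ ∘ suc))) (interchange (w zero) _ _ _)
wsum-+ (false ∷ A) w w′ = wsum-+ A (w ∘ suc) (w′ ∘ suc)

wsum-const : ∀ (A : Subset n) c → wsum A (λ _ → c) ≡ ∣ A ∣ * c
wsum-const []          c = refl
wsum-const (true ∷ A)  c = cong (c +_) (wsum-const A c)
wsum-const (false ∷ A) c = wsum-const A c

wsum-insertAt : ∀ (A : Subset n) v (w : Fin (suc n) → ℕ) →
  wsum (insertAt A v false) w ≡ wsum A (w ∘ punchIn v)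
wsum-insertAt A           zero    w = refl
wsum-insertAt (true ∷ A)  (suc v) w = cong (w zero +_) (wsum-insertAt A v (w ∘ suc))
wsum-insertAt (false ∷ A) (suc v) w = wsum-insertAt A v (w ∘ suc)

ssum-wsum : ∀ k (U : Subset m) (g : Fin m → Subset n → ℕ) →
  ssum k (λ A → wsum U (λ u → g u A)) ≡ wsum U (λ u → ssum k (g u))
ssum-wsum {n = n} k []          g = ssum-zero n k
ssum-wsum         k (true ∷ U)  g = trans (ssum-+ k (g zero) _) (cong (ssum k (g zero) +_) (ssum-wsum k U (g ∘ suc)))
ssum-wsum         k (false ∷ U) g = ssum-wsum k U (g ∘ suc)

sum-mono : ∀ {f g : Fin t → ℕ} → (∀ i → f i ≤ g i) → sum f ≤ sum g
sum-mono {zero}  h = z≤n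
sum-mono {suc t} h = +-mono-≤ (h zero) (sum-mono (h ∘ suc))

sum-mono-< : ∀ {f g : Fin t → ℕ} → (∀ i → f i ≤ g i) → ∀ j → f j < g j → sum f < sum g
sum-mono-< h zero    lt = +-mono-<-≤ lt (sum-mono (h ∘ suc))
sum-mono-< h (suc j) lt = +-mono-≤-< (h zero) (sum-mono-< (h ∘ suc) j lt)

≤sum : ∀ (f : Fin t → ℕ) i → f i ≤ sum f
≤sum f zero    = m≤m+n _ _
≤sum f (suc i) = ≤-trans (≤sum (f ∘ suc) i) (m≤n+m _ _)

sum-const : ∀ t c → sum {t} (λ _ → c) ≡ t * c
sum-const zero    c = refl
sum-const (suc t) c = cong (c +_) (sum-const t c)

δ : Fin t → Fin t → Bool
δ i j = Dec.does (i ≟ᶠ j)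

δ-true : ∀ {i j : Fin t} → δ i j ≡ true → i ≡ j
δ-true {i = i} {j} eq with i ≟ᶠ j
... | yes i≡j = i≡j

sum-δ : ∀ (j : Fin t) c → sum (λ i → ⟦ δ i j ⟧ * c) ≡ c
sum-δ {suc t} zero    c = trans (cong ((c + 0) +_) (trans (sum-const t 0) (*-zeroʳ t)))
                                (trans (+-identityʳ _) (+-identityʳ c))
sum-δ {suc t} (suc j) c = sum-δ j c

∣∷∣ : ∀ a (B : Subset n) → ∣ a ∷ B ∣ ≡ ⟦ a ⟧ + ∣ B ∣
∣∷∣ true  B = refl
∣∷∣ false B = refl

∣∣≡0⇒lookup : ∀ (A : Subset n) x → ∣ A ∣ ≡ 0 → lookup A x ≡ false
∣∣≡0⇒lookup (false ∷ A) zero    _  = refl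
∣∣≡0⇒lookup (false ∷ A) (suc x) eq = ∣∣≡0⇒lookup A x eq

true≢false : true ≢ false
true≢false ()

-- A common point forces equal indices, so the empty set may occur several times. This happens for r
-- = 1, where the links consist of the empty set.
Disjoint : (Fin t → Subset n) → Set
Disjoint A = ∀ i j x → lookup (A i) x ≡ true → lookup (A j) x ≡ true → i ≡ j

Rainbow : (Fin t → ℕ) → (Fin t → Subset n → Bool) → Set
Rainbow k F = ∃ λ A → Disjoint A × (∀ i → ∣ A i ∣ ≡ k i) × (∀ i → F i (A i) ≡ true)

-- Partitions of Fin m into parts of prescribed sizes

-- Sum of f over the sets formed by the first k entries of the m! orderings of Fin m (for k ≤ m);
-- the recursion follows the position of the point zero.
ordsum : ∀ {m} → ℕ → (Subset m → ℕ) → ℕ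
ordsum {zero}  k f = f []
ordsum {suc m} k f = k * ordsum (k ∸ 1) (f ∘ (true ∷_)) + (suc m ∸ k) * ordsum k (f ∘ (false ∷_))

ssum-large : ∀ k (f : Subset n → ℕ) → n < k → ssum k f ≡ 0
ssum-large {zero}  (suc k) f lt = refl
ssum-large {suc n} (suc k) f (s≤s lt) =
  cong₂ _+_ (ssum-large k (f ∘ (true ∷_)) lt) (ssum-large (suc k) (f ∘ (false ∷_)) (m≤n⇒m≤1+n lt))

-- A fixed k-set fills the first k places of exactly k! (m - k)! orderings.
ordsum-ssum : ∀ {m} k (f : Subset m → ℕ) → k ≤ m → ordsum k f ≡ k ! * (m ∸ k) ! * ssum k f
ordsum-ssum {zero}  zero    f k≤m = sym (+-identityʳ _)
ordsum-ssum {suc m} zero    f k≤m =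
  trans (cong (suc m *_) (ordsum-ssum zero (f ∘ (false ∷_)) z≤n)) (lemma (suc m) (m !) _)
  where
  lemma : ∀ a b c → a * (1 * b * c) ≡ 1 * (a * b) * c
  lemma = solve-∀
ordsum-ssum {suc m} (suc k) f (s≤s k≤m) with m≤n⇒m<n∨m≡n k≤m
-- Here the second `ordsum` asks for more entries than there are points; its coefficient m ∸ m
-- discards it.
... | inj₂ refl = begin
  suc m * ordsum m f₁ + (m ∸ m) * ordsum (suc m) f₀
    ≡⟨ cong₂ _+_ (cong (suc m *_) (ordsum-ssum m f₁ ≤-refl)) (cong (_* ordsum (suc m) f₀) (n∸n≡0 m)) ⟩
  suc m * (m ! * (m ∸ m) ! * ssum m f₁) + 0
    ≡⟨ lemma (suc m) (m !) _ _ ⟩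
  suc m * m ! * (m ∸ m) ! * (ssum m f₁ + 0)
    ≡⟨ cong (λ z → suc m * m ! * (m ∸ m) ! * (ssum m f₁ + z)) (ssum-large (suc m) f₀ ≤-refl) ⟨
  suc m * m ! * (m ∸ m) ! * (ssum m f₁ + ssum (suc m) f₀) ∎
  where
  open ≡-Reasoning
  f₁ = f ∘ (true ∷_)
  f₀ = f ∘ (false ∷_)
  lemma : ∀ a b c d → a * (b * c * d) + 0 ≡ a * b * c * (d + 0)
  lemma = solve-∀
... | inj₁ k<m = begin
  suc k * ordsum k f₁ + (m ∸ k) * ordsum (suc k) f₀
    ≡⟨ cong₂ _+_ (cong (suc k *_) (ordsum-ssum k f₁ k≤m)) (cong ((m ∸ k) *_) (ordsum-ssum (suc k) f₀ k<m)) ⟩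
  suc k * (k ! * (m ∸ k) ! * ssum k f₁) + (m ∸ k) * (suc k * k ! * (m ∸ suc k) ! * ssum (suc k) f₀)
    ≡⟨ lemma₁ (suc k) (k !) ((m ∸ k) !) _ (m ∸ k) _ _ ⟩
  suc k * k ! * (m ∸ k) ! * ssum k f₁ + suc k * k ! * ((m ∸ k) * (m ∸ suc k) !) * ssum (suc k) f₀
    ≡⟨ cong (λ z → suc k * k ! * (m ∸ k) ! * ssum k f₁ + suc k * k ! * z * ssum (suc k) f₀)
            ([n-k]*[n-k-1]!≡[n-k]! k<m) ⟩
  suc k * k ! * (m ∸ k) ! * ssum k f₁ + suc k * k ! * (m ∸ k) ! * ssum (suc k) f₀
    ≡⟨ *-distribˡ-+ (suc k * k ! * (m ∸ k) !) _ _ ⟨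
  suc k * k ! * (m ∸ k) ! * (ssum k f₁ + ssum (suc k) f₀) ∎
  where
  open ≡-Reasoning
  f₁ = f ∘ (true ∷_)
  f₀ = f ∘ (false ∷_)
  lemma₁ : ∀ a b c d e f g → a * (b * c * d) + e * (a * b * f * g) ≡ a * b * c * d + a * b * (e * f) * g
  lemma₁ = solve-∀

ordsum-zero : ∀ m k → ordsum {m} k (λ _ → 0) ≡ 0
ordsum-zero zero    k = refl
ordsum-zero (suc m) k =
  trans (cong₂ (λ a b → k * a + (suc m ∸ k) * b) (ordsum-zero m (k ∸ 1)) (ordsum-zero m k))
        (cong₂ _+_ (*-zeroʳ k) (*-zeroʳ (suc m ∸ k)))

ordsum-one : ∀ m k → k ≤ m → ordsum {m} k (λ _ → 1) ≡ m !
ordsum-one zero    k k≤m = refl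
ordsum-one (suc m) k k≤m = begin
  k * ordsum {m} (k ∸ 1) (λ _ → 1) + (suc m ∸ k) * ordsum {m} k (λ _ → 1)
    ≡⟨ cong₂ (λ a b → k * a + b) (ordsum-one m (k ∸ 1) (∸-monoˡ-≤ 1 k≤m)) step ⟩
  k * m ! + (suc m ∸ k) * m !
    ≡⟨ *-distribʳ-+ (m !) k (suc m ∸ k) ⟨
  (k + (suc m ∸ k)) * m !
    ≡⟨ cong (_* m !) (m+[n∸m]≡n k≤m) ⟩
  suc m * m ! ∎
  where
  open ≡-Reasoning
  step : (suc m ∸ k) * ordsum {m} k (λ _ → 1) ≡ (suc m ∸ k) * m !
  step with m≤n⇒m<n∨m≡n k≤m
  ... | inj₁ k<1+m = cong ((suc m ∸ k) *_) (ordsum-one m k (s≤s⁻¹ k<1+m))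
  ... | inj₂ refl  = trans (cong (_* ordsum {m} (suc m) (λ _ → 1)) (n∸n≡0 m)) (sym (cong (_* m !) (n∸n≡0 m)))

-- Both sides count the orderings of m + 1 points that have the point zero among the first k.
weighted-star : ∀ m k → k ≤ suc m → k ! * (suc m ∸ k) ! * star (suc m) k ≡ k * m !
weighted-star m k k≤ = begin
  k ! * (suc m ∸ k) ! * star (suc m) k
    ≡⟨ cong (k ! * (suc m ∸ k) ! *_) (ssum-star k zero) ⟨
  k ! * (suc m ∸ k) ! * ssum k (λ A → ⟦ lookup A zero ⟧)
    ≡⟨ ordsum-ssum k (λ A → ⟦ lookup A zero ⟧) k≤ ⟨
  k * ordsum {m} (k ∸ 1) (λ _ → 1) + (suc m ∸ k) * ordsum {m} k (λ _ → 0)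
    ≡⟨ cong₂ (λ a b → k * a + (suc m ∸ k) * b) (ordsum-one m (k ∸ 1) (∸-monoˡ-≤ 1 k≤)) (ordsum-zero m k) ⟩
  k * m ! + (suc m ∸ k) * 0
    ≡⟨ trans (cong (k * m ! +_) (*-zeroʳ (suc m ∸ k))) (+-identityʳ _) ⟩
  k * m ! ∎
  where open ≡-Reasoning

Partition : (Fin t → ℕ) → (Fin t → Subset m → ℕ) → Set
Partition k g = ∃ λ A → Disjoint A × (∀ i → ∣ A i ∣ ≡ k i) × (∀ i → g i (A i) ≡ 0)

-- Averaging over the part containing the point zero, which is the i-th one with probability k i / m.
partition : ∀ {m t} (k : Fin t → ℕ) (g : Fin t → Subset m → ℕ) → sum k ≡ m →
  sum (λ i → ordsum (k i) (g i)) < m ! →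
  Partition k g
partition {zero} k g Σk≡0 lt =
  (λ _ → []) , (λ _ _ ()) ,
  (λ i → sym (n≤0⇒n≡0 (≤-trans (≤sum k i) (≤-reflexive Σk≡0)))) ,
  (λ i → n<1⇒n≡0 (≤-<-trans (≤sum (λ i → g i []) i) lt))
-- With zero in part j the remaining total is `a j` + `B` - `b j`; the test against m! is written
-- without subtraction.
partition {suc m} {t} k g Σk≡ lt = go (any? λ j → a j + B <? m ! + b j ×-dec 0 <? k j)
  where
  a b : Fin t → ℕ
  a i = ordsum (k i ∸ 1) (g i ∘ (true ∷_))
  b i = ordsum (k i) (g i ∘ (false ∷_))
  B = sum b
  go : Dec (∃ λ j → a j + B < m ! + b j × 0 < k j) → Partition k g
  go (yes (j , lt′ , 0<kj)) =
    (λ i → δ i j ∷ proj₁ ih i) , disj , sizes , λ i → proj₂ (proj₂ (proj₂ ih)) i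
    where
    k′ : Fin t → ℕ
    k′ i = k i ∸ ⟦ δ i j ⟧
    δ≤k : ∀ i → ⟦ δ i j ⟧ ≤ k i
    δ≤k i with i ≟ᶠ j
    ... | yes refl = 0<kj
    ... | no  _    = z≤n
    Σk′ : sum k′ ≡ m
    Σk′ = +-cancelʳ-≡ 1 _ _ (begin
      sum k′ + 1                            ≡⟨ cong (sum k′ +_) (sum-δ j 1) ⟨
      sum k′ + sum (λ i → ⟦ δ i j ⟧ * 1)    ≡⟨ ∑-distrib-+ k′ (λ i → ⟦ δ i j ⟧ * 1) ⟨
      sum (λ i → k′ i + ⟦ δ i j ⟧ * 1)      ≡⟨ sum-cong-≗ (λ i → trans (cong (k′ i +_) (*-identityʳ _)) (m∸n+n≡m (δ≤k i))) ⟩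
      sum k                                 ≡⟨ Σk≡ ⟩
      suc m                                 ≡⟨ +-comm 1 m ⟩
      m + 1                                 ∎)
      where open ≡-Reasoning
    g′ : Fin t → Subset m → ℕ
    g′ i = g i ∘ (δ i j ∷_)
    pointwise : ∀ i → ordsum (k′ i) (g′ i) + ⟦ δ i j ⟧ * b j ≡ ⟦ δ i j ⟧ * a j + b i
    pointwise i with i ≟ᶠ j
    ... | yes refl = cong₂ _+_ (sym (*-identityˡ (a j))) (*-identityˡ (b j))
    ... | no  _    = +-identityʳ _
    Σord : sum (λ i → ordsum (k′ i) (g′ i)) + b j ≡ a j + B
    Σord = begin
      sum (λ i → ordsum (k′ i) (g′ i)) + b j
        ≡⟨ cong (sum (λ i → ordsum (k′ i) (g′ i)) +_) (sum-δ j (b j)) ⟨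
      sum (λ i → ordsum (k′ i) (g′ i)) + sum (λ i → ⟦ δ i j ⟧ * b j)
        ≡⟨ ∑-distrib-+ (λ i → ordsum (k′ i) (g′ i)) (λ i → ⟦ δ i j ⟧ * b j) ⟨
      sum (λ i → ordsum (k′ i) (g′ i) + ⟦ δ i j ⟧ * b j)
        ≡⟨ sum-cong-≗ pointwise ⟩
      sum (λ i → ⟦ δ i j ⟧ * a j + b i)
        ≡⟨ ∑-distrib-+ (λ i → ⟦ δ i j ⟧ * a j) b ⟩
      sum (λ i → ⟦ δ i j ⟧ * a j) + B
        ≡⟨ cong (_+ B) (sum-δ j (a j)) ⟩
      a j + B ∎
      where open ≡-Reasoning
    ih : Partition k′ g′
    ih = partition k′ g′ Σk′ (+-cancelʳ-< (b j) _ _ (subst (_< m ! + b j) (sym Σord) lt′))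
    disj : Disjoint (λ i → δ i j ∷ proj₁ ih i)
    disj _ _ zero    p q = trans (δ-true p) (sym (δ-true q))
    disj i i′ (suc x) p q = proj₁ (proj₂ ih) i i′ x p q
    sizes : ∀ i → ∣ δ i j ∷ proj₁ ih i ∣ ≡ k i
    sizes i = trans (∣∷∣ (δ i j) (proj₁ ih i)) (trans (cong (⟦ δ i j ⟧ +_) (proj₁ (proj₂ (proj₂ ih)) i)) (m+[n∸m]≡n (δ≤k i)))
  -- Otherwise the reversed inequalities, weighted by `k j` and summed, give a total of at least (m
  -- + 1) · m!, because the weights add up to m + 1.
  go (no none) = contradiction lt (≤⇒≯ (+-cancelˡ-≤ (sum (λ i → k i * b i)) _ _ (begin
    sum (λ i → k i * b i) + suc m * m !
      ≡⟨ cong (λ z → sum (λ i → k i * b i) + z * m !) Σk≡ ⟨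
    sum (λ i → k i * b i) + sum k * m !
      ≡⟨ cong (sum (λ i → k i * b i) +_) (*-distribʳ-sum (m !) k) ⟩
    sum (λ i → k i * b i) + sum (λ i → k i * m !)
      ≡⟨ ∑-distrib-+ (λ i → k i * b i) (λ i → k i * m !) ⟨
    sum (λ i → k i * b i + k i * m !)
      ≤⟨ sum-mono bound ⟩
    sum (λ i → k i * a i + k i * B)
      ≡⟨ ∑-distrib-+ (λ i → k i * a i) (λ i → k i * B) ⟩
    sum (λ i → k i * a i) + sum (λ i → k i * B)
      ≡⟨ cong (sum (λ i → k i * a i) +_) (trans (sym (*-distribʳ-sum B k)) (trans (cong (_* B) Σk≡) (*-distribˡ-sum (suc m) b))) ⟩
    sum (λ i → k i * a i) + sum (λ i → suc m * b i)
      ≡⟨ cong (sum (λ i → k i * a i) +_) (sum-cong-≗ split) ⟩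
    sum (λ i → k i * a i) + sum (λ i → k i * b i + (suc m ∸ k i) * b i)
      ≡⟨ cong (sum (λ i → k i * a i) +_) (∑-distrib-+ (λ i → k i * b i) (λ i → (suc m ∸ k i) * b i)) ⟩
    sum (λ i → k i * a i) + (sum (λ i → k i * b i) + sum (λ i → (suc m ∸ k i) * b i))
      ≡⟨ x∙yz≈y∙xz (sum (λ i → k i * a i)) (sum (λ i → k i * b i)) _ ⟩
    sum (λ i → k i * b i) + (sum (λ i → k i * a i) + sum (λ i → (suc m ∸ k i) * b i))
      ≡⟨ cong (sum (λ i → k i * b i) +_) (∑-distrib-+ (λ i → k i * a i) (λ i → (suc m ∸ k i) * b i)) ⟨
    sum (λ i → k i * b i) + sum (λ i → k i * a i + (suc m ∸ k i) * b i) ∎)))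
    where
    open ≤-Reasoning
    bound : ∀ i → k i * b i + k i * m ! ≤ k i * a i + k i * B
    bound i with 0 <? k i
    ... | no ¬p rewrite n≤0⇒n≡0 (≮⇒≥ ¬p) = z≤n
    ... | yes 0<k = begin
      k i * b i + k i * m !  ≡⟨ *-distribˡ-+ (k i) (b i) (m !) ⟨
      k i * (b i + m !)      ≡⟨ cong (k i *_) (+-comm (b i) (m !)) ⟩
      k i * (m ! + b i)      ≤⟨ *-monoʳ-≤ (k i) (≮⇒≥ (λ lt″ → none (i , lt″ , 0<k))) ⟩
      k i * (a i + B)        ≡⟨ *-distribˡ-+ (k i) (a i) B ⟩
      k i * a i + k i * B    ∎
    split : ∀ i → suc m * b i ≡ k i * b i + (suc m ∸ k i) * b i
    split i = trans (cong (_* b i) (sym (m+[n∸m]≡n (≤-trans (≤sum k i) (≤-reflexive Σk≡)))))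
                    (*-distribʳ-+ (b i) (k i) (suc m ∸ k i))

⟦⟧+⟦not⟧ : ∀ b → ⟦ not b ⟧ + ⟦ b ⟧ ≡ 1
⟦⟧+⟦not⟧ true  = refl
⟦⟧+⟦not⟧ false = refl

-- A point lies in the share k i / (m + 1) of all `k i`-sets, so less than 1 - p · k i / (m + 1) of
-- them are outside `F i`. Over the p + 1 parts these shares sum to less than (p + 1) - p = 1, and
-- the union bound applies.
rainbow-partition : ∀ {m p} (k : Fin (suc p) → ℕ) (F : Fin (suc p) → Subset (suc m) → Bool) → sum k ≡ suc m →
  (∀ i → p * star (suc m) (k i) < ssum (k i) (⟦_⟧ ∘ F i)) → Rainbow k F
rainbow-partition {m} {p} k F Σk≡ big =
  let A , disj , sizes , zeros = partition k (λ i → ⟦_⟧ ∘ not ∘ F i) Σk≡ few-bad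
  in A , disj , sizes , λ i → good (F i (A i)) (zeros i)
  where
  good : ∀ b → ⟦ not b ⟧ ≡ 0 → b ≡ true
  good true _ = refl
  bad : Fin (suc p) → ℕ
  bad i = ordsum (k i) (⟦_⟧ ∘ not ∘ F i)
  k≤ : ∀ i → k i ≤ suc m
  k≤ i = ≤-trans (≤sum k i) (≤-reflexive Σk≡)
  bound : ∀ i → bad i + p * (k i * m !) < suc m !
  bound i = begin-strict
    bad i + p * (k i * m !)
      ≡⟨ cong₂ (λ x y → x + p * y) (ordsum-ssum (k i) (⟦_⟧ ∘ not ∘ F i) (k≤ i)) (sym (weighted-star m (k i) (k≤ i))) ⟩
    c * ssum (k i) (⟦_⟧ ∘ not ∘ F i) + p * (c * star (suc m) (k i))
      ≡⟨ lemma c (ssum (k i) (⟦_⟧ ∘ not ∘ F i)) p (star (suc m) (k i)) ⟩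
    c * (ssum (k i) (⟦_⟧ ∘ not ∘ F i) + p * star (suc m) (k i))
      <⟨ *-monoʳ-< c (+-monoʳ-< (ssum (k i) (⟦_⟧ ∘ not ∘ F i)) (big i)) ⟩
    c * (ssum (k i) (⟦_⟧ ∘ not ∘ F i) + ssum (k i) (⟦_⟧ ∘ F i))
      ≡⟨ cong (c *_) (ssum-+ (k i) (⟦_⟧ ∘ not ∘ F i) (⟦_⟧ ∘ F i)) ⟨
    c * ssum (k i) (λ A → ⟦ not (F i A) ⟧ + ⟦ F i A ⟧)
      ≡⟨ cong (c *_) (ssum-cong (k i) {g = λ _ → 1} (λ A _ → ⟦⟧+⟦not⟧ (F i A))) ⟩
    c * ssum {suc m} (k i) (λ _ → 1)
      ≡⟨ ordsum-ssum (k i) (λ _ → 1) (k≤ i) ⟨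
    ordsum {suc m} (k i) (λ _ → 1)
      ≡⟨ ordsum-one (suc m) (k i) (k≤ i) ⟩
    suc m ! ∎
    where
    open ≤-Reasoning
    c = k i ! * (suc m ∸ k i) !
    instance _ = k i !* (suc m ∸ k i) !≢0
    lemma : ∀ a b c d → a * b + c * (a * d) ≡ a * (b + c * d)
    lemma = solve-∀
  few-bad : sum bad < suc m !
  few-bad = +-cancelʳ-< (p * suc m !) _ _ (begin-strict
    sum bad + p * (suc m * m !)
      ≡⟨ cong (λ z → sum bad + p * (z * m !)) Σk≡ ⟨
    sum bad + p * (sum k * m !)
      ≡⟨ cong (sum bad +_) (trans (cong (p *_) (*-distribʳ-sum (m !) k)) (*-distribˡ-sum p (λ i → k i * m !))) ⟩
    sum bad + sum (λ i → p * (k i * m !))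
      ≡⟨ ∑-distrib-+ bad (λ i → p * (k i * m !)) ⟨
    sum (λ i → bad i + p * (k i * m !))
      <⟨ sum-mono-< (<⇒≤ ∘ bound) zero (bound zero) ⟩
    sum {suc p} (λ _ → suc m !)
      ≡⟨ sum-const (suc p) (suc m !) ⟩
    suc m ! + p * suc m ! ∎)
    where open ≤-Reasoning

-- Shifting the point zero to the point suc x

swap : Fin m → Subset (suc m) → Subset (suc m)
swap x (a ∷ B) = lookup B x ∷ (B [ x ]≔ a)

∣∷∷∣-comm : ∀ a b (D : Subset n) → ∣ a ∷ b ∷ D ∣ ≡ ∣ b ∷ a ∷ D ∣
∣∷∷∣-comm true  true  D = refl
∣∷∷∣-comm true  false D = refl
∣∷∷∣-comm false true  D = refl
∣∷∷∣-comm false false D = refl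

∣swap∣ : ∀ (x : Fin m) A → ∣ swap x A ∣ ≡ ∣ A ∣
∣swap∣ zero    (a ∷ b ∷ D) = ∣∷∷∣-comm b a D
∣swap∣ (suc x) (a ∷ b ∷ D) = begin
  ∣ lookup D x ∷ b ∷ (D [ x ]≔ a) ∣  ≡⟨ ∣∷∷∣-comm (lookup D x) b (D [ x ]≔ a) ⟩
  ∣ b ∷ swap x (a ∷ D) ∣             ≡⟨ ∣∷∣ b (swap x (a ∷ D)) ⟩
  ⟦ b ⟧ + ∣ swap x (a ∷ D) ∣         ≡⟨ cong (⟦ b ⟧ +_) (∣swap∣ x (a ∷ D)) ⟩
  ⟦ b ⟧ + ∣ a ∷ D ∣                  ≡⟨ ∣∷∣ b (a ∷ D) ⟨
  ∣ b ∷ a ∷ D ∣                      ≡⟨ ∣∷∷∣-comm b a D ⟩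
  ∣ a ∷ b ∷ D ∣                      ∎
  where open ≡-Reasoning

transposition : Fin m → Fin (suc m) → Fin (suc m)
transposition x zero    = suc x
transposition x (suc y) = if δ y x then zero else suc y

lookup-swap : ∀ (x : Fin m) A y → lookup (swap x A) y ≡ lookup A (transposition x y)
lookup-swap x (a ∷ B) zero = refl
lookup-swap x (a ∷ B) (suc y) with y ≟ᶠ x
... | yes refl = lookup∘update x B a
... | no y≢x   = lookup∘update′ y≢x B a

-- The compression that replaces zero by `suc x`, applied to each pair of sets exchanged by
-- `swap x`: the set with zero stays only if both are members, its partner is a member afterwards if
-- either was.
shift : Fin m → (Subset (suc m) → Bool) → Subset (suc m) → Bool
shift x F (a ∷ B) with a | lookup B x
... | true  | false = F (a ∷ B) ∧ F (swap x (a ∷ B))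
... | false | true  = F (a ∷ B) ∨ F (swap x (a ∷ B))
... | true  | true  = F (a ∷ B)
... | false | false = F (a ∷ B)

⟦∧⟧+⟦∨⟧ : ∀ p q → ⟦ p ∧ q ⟧ + ⟦ q ∨ p ⟧ ≡ ⟦ p ⟧ + ⟦ q ⟧
⟦∧⟧+⟦∨⟧ true  true  = refl
⟦∧⟧+⟦∨⟧ true  false = refl
⟦∧⟧+⟦∨⟧ false true  = refl
⟦∧⟧+⟦∨⟧ false false = refl

-- On every exchanged pair the values p and q become p ∧ q and q ∨ p, which have the same sum; all
-- other sets keep their value.
ssum-shift : ∀ k (x : Fin m) F → ssum k (⟦_⟧ ∘ shift x F) ≡ ssum k (⟦_⟧ ∘ F)
ssum-shift zero x F = ssum-cong zero empty
  where
  empty : ∀ B → ∣ B ∣ ≡ 0 → ⟦ shift x F (false ∷ B) ⟧ ≡ ⟦ F (false ∷ B) ⟧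
  empty B eq rewrite ∣∣≡0⇒lookup B x eq = refl
ssum-shift {suc m} (suc zero) zero F = begin
  ssum zero f₁₀ + (ssum zero f₀₁ + ssum 1 f₀₀)
    ≡⟨ +-assoc (ssum zero f₁₀) _ _ ⟨
  ssum zero f₁₀ + ssum zero f₀₁ + ssum 1 f₀₀
    ≡⟨ cong (_+ ssum 1 f₀₀) (ssum-+ zero f₁₀ f₀₁) ⟨
  ssum zero (λ D → f₁₀ D + f₀₁ D) + ssum 1 f₀₀
    ≡⟨ cong (_+ ssum 1 f₀₀) (ssum-cong zero (λ D _ → ⟦∧⟧+⟦∨⟧ (F (true ∷ false ∷ D)) _)) ⟩
  ssum zero (λ D → g₁₀ D + g₀₁ D) + ssum 1 f₀₀
    ≡⟨ cong (_+ ssum 1 f₀₀) (ssum-+ zero g₁₀ g₀₁) ⟩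
  ssum zero g₁₀ + ssum zero g₀₁ + ssum 1 f₀₀
    ≡⟨ +-assoc (ssum zero g₁₀) _ _ ⟩
  ssum zero g₁₀ + (ssum zero g₀₁ + ssum 1 f₀₀) ∎
  where
  open ≡-Reasoning
  f₁₀ f₀₁ f₀₀ g₁₀ g₀₁ : Subset m → ℕ
  f₁₀ D = ⟦ shift zero F (true ∷ false ∷ D) ⟧
  f₀₁ D = ⟦ shift zero F (false ∷ true ∷ D) ⟧
  f₀₀ D = ⟦ F (false ∷ false ∷ D) ⟧
  g₁₀ D = ⟦ F (true ∷ false ∷ D) ⟧
  g₀₁ D = ⟦ F (false ∷ true ∷ D) ⟧
ssum-shift {suc m} (suc (suc k)) zero F = begin
  (ssum k f₁₁ + ssum (suc k) f₁₀) + (ssum (suc k) f₀₁ + ssum (suc (suc k)) f₀₀)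
    ≡⟨ regroup (ssum k f₁₁) (ssum (suc k) f₁₀) _ _ ⟩
  (ssum k f₁₁ + ssum (suc (suc k)) f₀₀) + (ssum (suc k) f₁₀ + ssum (suc k) f₀₁)
    ≡⟨ cong (ssum k f₁₁ + ssum (suc (suc k)) f₀₀ +_) (ssum-+ (suc k) f₁₀ f₀₁) ⟨
  (ssum k f₁₁ + ssum (suc (suc k)) f₀₀) + ssum (suc k) (λ D → f₁₀ D + f₀₁ D)
    ≡⟨ cong (ssum k f₁₁ + ssum (suc (suc k)) f₀₀ +_)
            (ssum-cong (suc k) (λ D _ → ⟦∧⟧+⟦∨⟧ (F (true ∷ false ∷ D)) _)) ⟩
  (ssum k f₁₁ + ssum (suc (suc k)) f₀₀) + ssum (suc k) (λ D → g₁₀ D + g₀₁ D)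
    ≡⟨ cong (ssum k f₁₁ + ssum (suc (suc k)) f₀₀ +_) (ssum-+ (suc k) g₁₀ g₀₁) ⟩
  (ssum k f₁₁ + ssum (suc (suc k)) f₀₀) + (ssum (suc k) g₁₀ + ssum (suc k) g₀₁)
    ≡⟨ regroup (ssum k f₁₁) (ssum (suc k) g₁₀) _ _ ⟨
  (ssum k f₁₁ + ssum (suc k) g₁₀) + (ssum (suc k) g₀₁ + ssum (suc (suc k)) f₀₀) ∎
  where
  open ≡-Reasoning
  f₁₁ f₁₀ f₀₁ f₀₀ g₁₀ g₀₁ : Subset m → ℕ
  f₁₁ D = ⟦ F (true ∷ true ∷ D) ⟧
  f₁₀ D = ⟦ shift zero F (true ∷ false ∷ D) ⟧
  f₀₁ D = ⟦ shift zero F (false ∷ true ∷ D) ⟧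
  f₀₀ D = ⟦ F (false ∷ false ∷ D) ⟧
  g₁₀ D = ⟦ F (true ∷ false ∷ D) ⟧
  g₀₁ D = ⟦ F (false ∷ true ∷ D) ⟧
  regroup : ∀ a b c d → (a + b) + (c + d) ≡ (a + d) + (b + c)
  regroup = solve-∀
-- The point `suc zero` takes no part in the exchange. Fixing whether it belongs to the set leaves a
-- shift on one point fewer.
ssum-shift {suc m} (suc k) (suc x) F = begin
  ssum (suc k) (⟦_⟧ ∘ shift (suc x) F)
    ≡⟨ ssum-insertAt k (suc zero) (⟦_⟧ ∘ shift (suc x) F) ⟩
  ssum k (λ D → ⟦ shift (suc x) F (insertAt D (suc zero) true) ⟧) +
    ssum (suc k) (λ D → ⟦ shift (suc x) F (insertAt D (suc zero) false) ⟧)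
    ≡⟨ cong₂ _+_ (ssum-cong k (λ D _ → cong ⟦_⟧ (commute true D)))
                 (ssum-cong (suc k) (λ D _ → cong ⟦_⟧ (commute false D))) ⟩
  ssum k (⟦_⟧ ∘ shift x (Fₓ true)) + ssum (suc k) (⟦_⟧ ∘ shift x (Fₓ false))
    ≡⟨ cong₂ _+_ (ssum-shift k x (Fₓ true)) (ssum-shift (suc k) x (Fₓ false)) ⟩
  ssum k (⟦_⟧ ∘ Fₓ true) + ssum (suc k) (⟦_⟧ ∘ Fₓ false)
    ≡⟨ ssum-insertAt k (suc zero) (⟦_⟧ ∘ F) ⟨
  ssum (suc k) (⟦_⟧ ∘ F) ∎
  where
  open ≡-Reasoning
  Fₓ : Bool → Subset (suc m) → Bool
  Fₓ b D = F (insertAt D (suc zero) b)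
  commute : ∀ b D → shift (suc x) F (insertAt D (suc zero) b) ≡ shift x (Fₓ b) D
  commute b (true ∷ D) with lookup D x
  ... | true  = refl
  ... | false = refl
  commute b (false ∷ D) with lookup D x
  ... | true  = refl
  ... | false = refl

∧-intro : ∀ {p q} → p ≡ true → q ≡ true → p ∧ q ≡ true
∧-intro refl eq = eq

∨-introˡ : ∀ {p q} → p ≡ true → p ∨ q ≡ true
∨-introˡ refl = refl

-- If the j-th set of a rainbow family of the shifted hypergraphs is new, it is the only one to
-- contain suc x, and then swapping zero and suc x in all sets gives a rainbow family of the originals.
shift-rainbow : ∀ {k : Fin t → ℕ} {F : Fin t → Subset (suc m) → Bool} x →
  Rainbow k (shift x ∘ F) → Rainbow k F
shift-rainbow {t} {m} {k} {F} x (A , disj , sizes , mem) with any? (λ j → F j (A j) ≟ᵇ false)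
... | no none = A , disj , sizes , λ i → ¬-not (λ eq → none (i , eq))
... | yes (j , Fj≡false) =
  swap x ∘ A ,
  (λ i i′ y p q → disj i i′ (transposition x y) (trans (sym (lookup-swap x (A i) y)) p)
                                                (trans (sym (lookup-swap x (A i′) y)) q)) ,
  (λ i → trans (∣swap∣ x (A i)) (sizes i)) ,
  mem′
  where
  new : ∀ A → F j A ≡ false → shift x (F j) A ≡ true → lookup A (suc x) ≡ true × F j (swap x A) ≡ true
  new (a ∷ B) eq eq′ with a | lookup B x in eqx
  ... | true  | false rewrite eq = case eq′ of λ ()
  ... | false | true  rewrite eq = refl , trans (cong (λ b → F j (b ∷ (B [ x ]≔ false))) (sym eqx)) eq′
  ... | true  | true  = contradiction (trans (sym eq′) eq) true≢false
  ... | false | false = contradiction (trans (sym eq′) eq) true≢false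
  old : ∀ i A → lookup A (suc x) ≡ false → shift x (F i) A ≡ true → F i (swap x A) ≡ true
  old i (a ∷ B) eq eq′ with a | lookup B x in eqx
  ... | true  | false = trans (cong (λ b → F i (b ∷ (B [ x ]≔ true))) (sym eqx)) (∧-conicalʳ (F i (true ∷ B)) _ eq′)
  ... | false | false = trans (cong (λ D → F i (false ∷ D)) (trans (cong (B [ x ]≔_) (sym eqx)) ([]≔-lookup B x))) eq′
  mem′ : ∀ i → F i (swap x (A i)) ≡ true
  mem′ i with i ≟ᶠ j
  ... | yes refl = proj₂ (new (A j) Fj≡false (mem j))
  ... | no i≢j   = old i (A i) (¬-not (λ eq → i≢j (disj i j (suc x) eq (proj₁ (new (A j) Fj≡false (mem j)))))) (mem i)

Stable : Fin m → (Subset (suc m) → Bool) → Set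
Stable x F = ∀ B → F (true ∷ B) ≡ true → lookup B x ≡ false → F (false ∷ (B [ x ]≔ true)) ≡ true

shift-stable : ∀ x (F : Subset (suc m) → Bool) → Stable x (shift x F)
shift-stable x F B eq eqx rewrite eqx | lookup∘update x B true = 
  ∨-introˡ (trans (cong (λ b → F (b ∷ (B [ x ]≔ true))) (sym eqx)) (∧-conicalʳ (F (true ∷ B)) _ eq))

-- A shift removes only sets that contain zero and adds only sets that avoid it, so replacements
-- available before are still there.
shift-preserves-stable : ∀ x y (F : Subset (suc m) → Bool) → Stable y F → Stable y (shift x F)
shift-preserves-stable x y F stable B eq eqy = grow (B [ y ]≔ true) (stable B (shrink B eq) eqy)
  where
  shrink : ∀ B → shift x F (true ∷ B) ≡ true → F (true ∷ B) ≡ true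
  shrink B eq with lookup B x
  ... | true  = eq
  ... | false = ∧-conicalˡ _ _ eq
  grow : ∀ B → F (false ∷ B) ≡ true → shift x F (false ∷ B) ≡ true
  grow B eq with lookup B x
  ... | true  = ∨-introˡ eq
  ... | false = eq

-- One pass over the points suffices, since a shift preserves stability with respect to the others.
shift-all : ∀ (xs : List (Fin m)) (k : Fin t → ℕ) (F : Fin t → Subset (suc m) → Bool) →
  ∃ λ (G : Fin t → Subset (suc m) → Bool) →
    (∀ i → ssum (k i) (⟦_⟧ ∘ G i) ≡ ssum (k i) (⟦_⟧ ∘ F i)) ×
    (Rainbow k G → Rainbow k F) ×
    (∀ i → All (λ x → Stable x (G i)) xs)
shift-all []       k F = F , (λ _ → refl) , (λ r → r) , λ _ → []
shift-all (x ∷ xs) k F =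
  let G , counts , back , stable = shift-all xs k F in
  (λ i → shift x (G i)) ,
  (λ i → trans (ssum-shift (k i) x (G i)) (counts i)) ,
  back ∘ shift-rainbow x ,
  λ i → shift-stable x (G i) ∷ All.map (λ {y} → shift-preserves-stable x y (G i)) (stable i)

-- Unions and free points

⋃ : (Fin t → Subset n) → Subset n
⋃ {zero}  A = ⊥
⋃ {suc t} A = A zero ∪ ⋃ (A ∘ suc)

∣∪∣≤ : ∀ (A B : Subset n) → ∣ A ∪ B ∣ ≤ ∣ A ∣ + ∣ B ∣
∣∪∣≤ []          []          = z≤n
∣∪∣≤ (true ∷ A)  (true ∷ B)  = s≤s (≤-trans (∣∪∣≤ A B) (+-monoʳ-≤ ∣ A ∣ (n≤1+n _)))
∣∪∣≤ (true ∷ A)  (false ∷ B) = s≤s (∣∪∣≤ A B)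
∣∪∣≤ (false ∷ A) (true ∷ B)  = ≤-trans (s≤s (∣∪∣≤ A B)) (≤-reflexive (sym (+-suc _ _)))
∣∪∣≤ (false ∷ A) (false ∷ B) = ∣∪∣≤ A B

∣⋃∣≤ : ∀ (A : Fin t → Subset n) → ∣ ⋃ A ∣ ≤ sum (λ i → ∣ A i ∣)
∣⋃∣≤ {zero} {n} A = ≤-reflexive (∣⊥∣≡0 n)
∣⋃∣≤ {suc t}    A = ≤-trans (∣∪∣≤ (A zero) (⋃ (A ∘ suc))) (+-monoʳ-≤ ∣ A zero ∣ (∣⋃∣≤ (A ∘ suc)))

∉⋃⇒∉ : ∀ (A : Fin t → Subset n) x → lookup (⋃ A) x ≡ false → ∀ i → lookup (A i) x ≡ false
∉⋃⇒∉ {suc t} A x eq i with lookup (A zero) x in eq₀ | lookup-zipWith _∨_ x (A zero) (⋃ (A ∘ suc))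
∉⋃⇒∉ {suc t} A x eq i       | true  | eq₁ = contradiction (trans (sym eq₁) eq) true≢false
∉⋃⇒∉ {suc t} A x eq zero    | false | eq₁ = eq₀
∉⋃⇒∉ {suc t} A x eq (suc i) | false | eq₁ = ∉⋃⇒∉ (A ∘ suc) x (trans (sym eq₁) eq) i

free-point : ∀ (U : Subset n) → ∣ U ∣ < n → ∃ λ x → lookup U x ≡ false
free-point (true ∷ U)  (s≤s lt) = let x , eq = free-point U lt in suc x , eq
free-point (false ∷ U) lt       = zero , refl

∣[]≔true∣ : ∀ (A : Subset n) x → lookup A x ≡ false → ∣ A [ x ]≔ true ∣ ≡ suc ∣ A ∣
∣[]≔true∣ (false ∷ A) zero    eq = refl
∣[]≔true∣ (true ∷ A)  (suc x) eq = cong suc (∣[]≔true∣ A x eq)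
∣[]≔true∣ (false ∷ A) (suc x) eq = ∣[]≔true∣ A x eq

all-or-any : ∀ {P Q : Fin t → Set} → (∀ i → P i ⊎ Q i) → (∀ i → P i) ⊎ ∃ Q
all-or-any {zero}  h = inj₁ λ ()
all-or-any {suc t} h with h zero | all-or-any (h ∘ suc)
... | inj₂ q | _            = inj₂ (zero , q)
... | inj₁ p | inj₂ (i , q) = inj₂ (suc i , q)
... | inj₁ p | inj₁ ps      = inj₁ λ { zero → p ; (suc i) → ps i }

-- A set that is either a k-element member of G, or lacks one point, which may be any point
-- outside it: zero because it comes from a member containing zero, another one by stability.
Extendable : ℕ → (Subset (suc m) → Bool) → Subset (suc m) → Set
Extendable k G A =
  (∣ A ∣ ≡ k × G A ≡ true) ⊎
  (suc ∣ A ∣ ≡ k × ∃ λ B → A ≡ false ∷ B × G (true ∷ B) ≡ true)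

-- While some set is short, the sizes add up to less than `sum k` ≤ m + 1, so some point lies in
-- none of the sets and completes a short one. The fuel `d` bounds the number of points still
-- missing.
extend : ∀ {m t} {k : Fin t → ℕ} {G : Fin t → Subset (suc m) → Bool} → (∀ i x → Stable x (G i)) →
  sum k ≤ suc m → ∀ d (A : Fin t → Subset (suc m)) → Disjoint A → (∀ i → Extendable (k i) (G i) (A i)) →
  sum k ≤ d + sum (λ i → ∣ A i ∣) → Rainbow k G
extend {m} {t} {k} {G} stable Σk≤ d A disj ext Σk≤d with all-or-any ext
... | inj₁ done = A , disj , proj₁ ∘ done , proj₂ ∘ done
... | inj₂ (i , size , B , Ai≡ , GB) = go d Σk≤d
  where
  ≤k : ∀ {j} → Extendable (k j) (G j) (A j) → ∣ A j ∣ ≤ k j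
  ≤k (inj₁ (eq , _)) = ≤-reflexive eq
  ≤k (inj₂ (eq , _)) = ≤-trans (n≤1+n _) (≤-reflexive eq)
  Σ< : sum (λ j → ∣ A j ∣) < sum k
  Σ< = sum-mono-< (≤k ∘ ext) i (≤-reflexive size)
  free = free-point (⋃ A) (≤-<-trans (∣⋃∣≤ A) (≤-trans Σ< Σk≤))
  x = proj₁ free
  x∉ = ∉⋃⇒∉ A x (proj₂ free)
  A′ : Fin t → Subset (suc m)
  A′ j = if δ j i then A j [ x ]≔ true else A j
  ∈A′ : ∀ j y → lookup (A′ j) y ≡ true → (y ≡ x × j ≡ i) ⊎ (y ≢ x × lookup (A j) y ≡ true)
  ∈A′ j y eq with j ≟ᶠ i | y ≟ᶠ x
  ... | yes p | yes q    = inj₁ (q , p)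
  ... | yes p | no y≢x   = inj₂ (y≢x , trans (sym (lookup∘update′ y≢x (A j) true)) eq)
  ... | no _  | yes refl = contradiction (trans (sym eq) (x∉ j)) true≢false
  ... | no _  | no y≢x   = inj₂ (y≢x , eq)
  disj′ : Disjoint A′
  disj′ j j′ y p q with ∈A′ j y p | ∈A′ j′ y q
  ... | inj₁ (_ , refl)   | inj₁ (_ , refl)   = refl
  ... | inj₁ (y≡x , _)    | inj₂ (y≢x , _)    = contradiction y≡x y≢x
  ... | inj₂ (y≢x , _)    | inj₁ (y≡x , _)    = contradiction y≡x y≢x
  ... | inj₂ (_ , p′)     | inj₂ (_ , q′)     = disj j j′ y p′ q′
  extended : ∀ x → lookup (A i) x ≡ false → G i (A i [ x ]≔ true) ≡ true
  extended zero    _  = subst (λ S → G i (S [ zero ]≔ true) ≡ true) (sym Ai≡) GB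
  extended (suc y) eq = subst (λ S → G i (S [ suc y ]≔ true) ≡ true) (sym Ai≡)
    (stable i y B GB (trans (cong (λ S → lookup S (suc y)) (sym Ai≡)) eq))
  ext′ : ∀ j → Extendable (k j) (G j) (A′ j)
  ext′ j with j ≟ᶠ i
  ... | yes refl = inj₁ (trans (∣[]≔true∣ (A i) x (x∉ i)) size , extended x (x∉ i))
  ... | no _     = ext j
  Σ′ : sum (λ j → ∣ A′ j ∣) ≡ suc (sum (λ j → ∣ A j ∣))
  Σ′ = begin
    sum (λ j → ∣ A′ j ∣)                                ≡⟨ sum-cong-≗ pointwise ⟩
    sum (λ j → ⟦ δ j i ⟧ * 1 + ∣ A j ∣)                 ≡⟨ ∑-distrib-+ (λ j → ⟦ δ j i ⟧ * 1) (λ j → ∣ A j ∣) ⟩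
    sum (λ j → ⟦ δ j i ⟧ * 1) + sum (λ j → ∣ A j ∣)     ≡⟨ cong (_+ sum (λ j → ∣ A j ∣)) (sum-δ i 1) ⟩
    suc (sum (λ j → ∣ A j ∣))                           ∎
    where
    open ≡-Reasoning
    pointwise : ∀ j → ∣ A′ j ∣ ≡ ⟦ δ j i ⟧ * 1 + ∣ A j ∣
    pointwise j with j ≟ᶠ i
    ... | yes refl = ∣[]≔true∣ (A i) x (x∉ i)
    ... | no _     = refl
  go : ∀ d → sum k ≤ d + sum (λ j → ∣ A j ∣) → Rainbow k G
  go zero    Σk≤ΣA = contradiction Σ< (≤⇒≯ Σk≤ΣA)
  go (suc d) Σk≤d = extend {G = G} stable Σk≤ d A′ disj′ ext′
    (≤-trans Σk≤d (≤-reflexive (trans (sym (+-suc d _)) (cong (d +_) (sym Σ′)))))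

-- The Huang-Loh-Sudakov lemma

star-superadditive : ∀ m k → star m k + star m (suc k) ≤ star (suc m) (suc k)
-- Pascal's rule fails at k = 0, where the left side is 0 and the right side 1; hence an inequality.
star-superadditive zero    k = z≤n
star-superadditive (suc m) k = ≤-reflexive (sym (star-pascal m k))

large-half : ∀ p k (G : Subset (suc m) → Bool) → p * star (suc m) k < ssum k (⟦_⟧ ∘ G) →
  ∃ λ c → ⟦ c ⟧ ≤ k × p * star m (k ∸ ⟦ c ⟧) < ssum (k ∸ ⟦ c ⟧) (⟦_⟧ ∘ G ∘ (c ∷_))
large-half {zero}  p zero G lt = false , z≤n , lt
large-half {suc m} p zero G lt = false , z≤n , lt
large-half {m} p (suc k) G lt
  with +-split-< (p * star m k) (≤-<-trans (≤-trans (≤-reflexive (sym (*-distribˡ-+ p (star m k) (star m (suc k)))))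
                                                    (*-monoʳ-≤ p (star-superadditive m k))) lt)
... | inj₁ lt₁ = true , s≤s z≤n , lt₁
... | inj₂ lt₀ = false , z≤n , lt₀

-- For sum k = m, a random ordered partition into parts of sizes k i works. For sum k < m, shift all
-- families away from zero; by Pascal's rule the members containing zero or those avoiding it
-- are numerous enough for the induction on m, and the point zero lost in the former is replaced afterwards.
rainbow : ∀ m p (k : Fin (suc p) → ℕ) (F : Fin (suc p) → Subset m → Bool) → sum k ≤ m →
  (∀ i → p * star m (k i) < ssum (k i) (⟦_⟧ ∘ F i)) → Rainbow k F
rainbow zero p k F Σk≤ big =
  (λ i → proj₁ (member i)) , (λ _ _ ()) , (λ i → proj₁ (proj₂ (member i))) , λ i → proj₂ (proj₂ (member i))
  where member = λ i → ssum-member (k i) {F i} (≤-<-trans z≤n (big i))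
rainbow (suc m) p k F Σk≤ big with m≤n⇒m<n∨m≡n Σk≤
... | inj₂ Σk≡  = rainbow-partition k F Σk≡ big
... | inj₁ Σk<  =
  let B , disj , sizes , mem = rainbow m p k′ F′ (≤-trans (sum-mono (λ i → m∸n≤m (k i) ⟦ c i ⟧)) (s≤s⁻¹ Σk<))
                                       (λ i → proj₂ (proj₂ (half i)))
  in back (extend {G = G} (λ i x → All.lookup (stable i) (∈-allFin x)) Σk≤ (sum k) (λ i → false ∷ B i)
       (λ { i j (suc x) p q → disj i j x p q })
       (λ i → ext i (c i) (proj₁ (proj₂ (half i))) (B i) (sizes i) (mem i))
       (m≤m+n (sum k) _))
  where
  shifted = shift-all (allFin m) k F
  G = proj₁ shifted
  back = proj₁ (proj₂ (proj₂ shifted))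
  stable = proj₂ (proj₂ (proj₂ shifted))
  half = λ i → large-half p (k i) (G i) (subst (p * star (suc m) (k i) <_) (sym (proj₁ (proj₂ shifted) i)) (big i))
  c : Fin (suc p) → Bool
  c i = proj₁ (half i)
  k′ : Fin (suc p) → ℕ
  k′ i = k i ∸ ⟦ c i ⟧
  F′ : Fin (suc p) → Subset m → Bool
  F′ i = G i ∘ (c i ∷_)
  ext : ∀ i c → ⟦ c ⟧ ≤ k i → ∀ B → ∣ B ∣ ≡ k i ∸ ⟦ c ⟧ → G i (c ∷ B) ≡ true →
    Extendable (k i) (G i) (false ∷ B)
  ext i true  1≤k B eq mem = inj₂ (trans (cong suc eq) (m+[n∸m]≡n 1≤k) , B , refl , mem)
  ext i false _   B eq mem = inj₁ (eq , mem)

-- Degrees, links and matchings of a family E of r-subsets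

Matching : ℕ → ℕ → (Subset n → Bool) → Set
Matching s r E = Rainbow {t = s} (λ _ → r) (λ _ → E)

degree : ℕ → (Subset n → Bool) → Fin n → ℕ
degree r E v = ssum r (λ A → ⟦ E A ∧ lookup A v ⟧)

-- The link stays on the full vertex set, so that links of different vertices share a ground set as
-- `rainbow` requires. The price is the bound `star n k` = C(n-1, k-1) in place of the exact
-- codegree bound C(n-2, k-1).
link : (Subset n → Bool) → Fin n → Subset n → Bool
link E v B = E (B [ v ]≔ true) ∧ not (lookup B v)

not-true : ∀ {b} → not b ≡ true → b ≡ false
not-true {false} _ = refl

⟦∧⟧≤ʳ : ∀ p q → ⟦ p ∧ q ⟧ ≤ ⟦ q ⟧
⟦∧⟧≤ʳ true  q = ≤-refl
⟦∧⟧≤ʳ false q = z≤n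

⟦∧⟧≤ˡ : ∀ p q → ⟦ p ∧ q ⟧ ≤ ⟦ p ⟧
⟦∧⟧≤ˡ true  q = ⟦ q ⟧≤1
⟦∧⟧≤ˡ false q = z≤n

insertAt-[]≔ : ∀ (B : Subset n) v b c → insertAt B v b [ v ]≔ c ≡ insertAt B v c
insertAt-[]≔ B       zero    b c = refl
insertAt-[]≔ (a ∷ B) (suc v) b c = cong (a ∷_) (insertAt-[]≔ B v b c)

∣insertAt∣ : ∀ (B : Subset n) v b → ∣ insertAt B v b ∣ ≡ ⟦ b ⟧ + ∣ B ∣
∣insertAt∣ B       zero    b = ∣∷∣ b B
∣insertAt∣ (a ∷ B) (suc v) b = begin
  ∣ a ∷ insertAt B v b ∣     ≡⟨ ∣∷∣ a (insertAt B v b) ⟩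
  ⟦ a ⟧ + ∣ insertAt B v b ∣ ≡⟨ cong (⟦ a ⟧ +_) (∣insertAt∣ B v b) ⟩
  ⟦ a ⟧ + (⟦ b ⟧ + ∣ B ∣)    ≡⟨ x∙yz≈y∙xz ⟦ a ⟧ ⟦ b ⟧ ∣ B ∣ ⟩
  ⟦ b ⟧ + (⟦ a ⟧ + ∣ B ∣)    ≡⟨ cong (⟦ b ⟧ +_) (∣∷∣ a B) ⟨
  ⟦ b ⟧ + ∣ a ∷ B ∣          ∎
  where open ≡-Reasoning

lookup-insertAt : ∀ (B : Subset n) v x → lookup (insertAt B v false) x ≡ true →
  ∃ λ y → x ≡ punchIn v y × lookup B y ≡ true
lookup-insertAt B v x eq with v ≟ᶠ x
... | yes refl = contradiction (trans (sym eq) (insertAt-lookup B v false)) true≢false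
... | no v≢x   = punchOut v≢x , sym (punchIn-punchOut v≢x) ,
  trans (sym (insertAt-punchIn B v false (punchOut v≢x)))
        (trans (cong (lookup (insertAt B v false)) (punchIn-punchOut v≢x)) eq)

ssum-link : ∀ k (E : Subset n → Bool) v → ssum k (⟦_⟧ ∘ link E v) ≡ degree (suc k) E v
ssum-link {suc n} k E v = begin
  ssum k (⟦_⟧ ∘ link E v)
    ≡⟨ avoiding k ⟩
  ssum k (λ B → ⟦ link E v (insertAt B v false) ⟧)
    ≡⟨ ssum-cong k (λ B _ → cong ⟦_⟧ (cong₂ _∧_ (cong E (insertAt-[]≔ B v false true)) (in-link B))) ⟩
  ssum k (λ B → ⟦ E (insertAt B v true) ∧ lookup (insertAt B v true) v ⟧)
    ≡⟨ +-identityʳ _ ⟨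
  ssum k (λ B → ⟦ E (insertAt B v true) ∧ lookup (insertAt B v true) v ⟧) + 0
    ≡⟨ cong (ssum k (λ B → ⟦ E (insertAt B v true) ∧ lookup (insertAt B v true) v ⟧) +_)
            (trans (sym (ssum-zero n (suc k))) (ssum-cong (suc k) (λ B _ → sym (missing B)))) ⟩
  ssum k (λ B → ⟦ E (insertAt B v true) ∧ lookup (insertAt B v true) v ⟧) +
    ssum (suc k) (λ B → ⟦ E (insertAt B v false) ∧ lookup (insertAt B v false) v ⟧)
    ≡⟨ ssum-insertAt k v (λ A → ⟦ E A ∧ lookup A v ⟧) ⟨
  degree (suc k) E v ∎
  where
  open ≡-Reasoning
  in-link : ∀ B → not (lookup (insertAt B v false) v) ≡ lookup (insertAt B v true) v
  in-link B = trans (cong not (insertAt-lookup B v false)) (sym (insertAt-lookup B v true))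
  missing : ∀ B → ⟦ E (insertAt B v false) ∧ lookup (insertAt B v false) v ⟧ ≡ 0
  missing B = trans (cong (λ b → ⟦ E (insertAt B v false) ∧ b ⟧) (insertAt-lookup B v false)) (cong ⟦_⟧ (∧-zeroʳ _))
  not-link : ∀ B → ⟦ link E v (insertAt B v true) ⟧ ≡ 0
  not-link B = trans (cong (λ b → ⟦ E (insertAt B v true [ v ]≔ true) ∧ not b ⟧) (insertAt-lookup B v true))
                     (cong ⟦_⟧ (∧-zeroʳ _))
  avoiding : ∀ k → ssum k (⟦_⟧ ∘ link E v) ≡ ssum k (λ B → ⟦ link E v (insertAt B v false) ⟧)
  avoiding zero    = ssum-zero-insertAt v (⟦_⟧ ∘ link E v)
  avoiding (suc k) = begin
    ssum (suc k) (⟦_⟧ ∘ link E v)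
      ≡⟨ ssum-insertAt k v (⟦_⟧ ∘ link E v) ⟩
    ssum k (λ B → ⟦ link E v (insertAt B v true) ⟧) + ssum (suc k) (λ B → ⟦ link E v (insertAt B v false) ⟧)
      ≡⟨ cong (_+ ssum (suc k) (λ B → ⟦ link E v (insertAt B v false) ⟧))
              (trans (ssum-cong k (λ B _ → not-link B)) (ssum-zero n k)) ⟩
    ssum (suc k) (λ B → ⟦ link E v (insertAt B v false) ⟧) ∎

avoids : Subset n → Subset n → Bool
avoids []          []      = true
avoids (true ∷ U)  (a ∷ A) = not a ∧ avoids U A
avoids (false ∷ U) (a ∷ A) = avoids U A

avoids⇒∉ : ∀ (U A : Subset n) → avoids U A ≡ true → ∀ x → lookup U x ≡ true → lookup A x ≡ false
avoids⇒∉ (true ∷ U)  (a ∷ A) eq zero    _  = not-true (∧-conicalˡ _ _ eq)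
avoids⇒∉ (true ∷ U)  (a ∷ A) eq (suc x) eqx = avoids⇒∉ U A (∧-conicalʳ (not a) _ eq) x eqx
avoids⇒∉ (false ∷ U) (a ∷ A) eq (suc x) eqx = avoids⇒∉ U A eq x eqx

⊆∁⇒avoids : ∀ (U A : Subset n) → (∀ x → lookup A x ≡ true → lookup (∁ U) x ≡ true) → avoids U A ≡ true
⊆∁⇒avoids []          []          h = refl
⊆∁⇒avoids (true ∷ U)  (true ∷ A)  h = contradiction (sym (h zero refl)) true≢false
⊆∁⇒avoids (true ∷ U)  (false ∷ A) h = ⊆∁⇒avoids U A (h ∘ suc)
⊆∁⇒avoids (false ∷ U) (a ∷ A)     h = ⊆∁⇒avoids U A (h ∘ suc)

meets-or-avoids : ∀ (U A : Subset n) → 1 ≤ ⟦ avoids U A ⟧ + wsum U (λ u → ⟦ lookup A u ⟧)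
meets-or-avoids []          []          = ≤-refl
meets-or-avoids (true ∷ U)  (true ∷ A)  = s≤s z≤n
meets-or-avoids (true ∷ U)  (false ∷ A) = meets-or-avoids U A
meets-or-avoids (false ∷ U) (a ∷ A)     = meets-or-avoids U A

union-bound : ∀ k (F : Subset n → Bool) U →
  ssum k (⟦_⟧ ∘ F) ≤ ssum k (λ A → ⟦ F A ∧ avoids U A ⟧) + wsum U (degree k F)
union-bound k F U = begin
  ssum k (⟦_⟧ ∘ F)
    ≤⟨ ssum-mono k (λ A _ → pointwise A) ⟩
  ssum k (λ A → ⟦ F A ∧ avoids U A ⟧ + wsum U (λ u → ⟦ F A ∧ lookup A u ⟧))
    ≡⟨ ssum-+ k (λ A → ⟦ F A ∧ avoids U A ⟧) (λ A → wsum U (λ u → ⟦ F A ∧ lookup A u ⟧)) ⟩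
  ssum k (λ A → ⟦ F A ∧ avoids U A ⟧) + ssum k (λ A → wsum U (λ u → ⟦ F A ∧ lookup A u ⟧))
    ≡⟨ cong (ssum k (λ A → ⟦ F A ∧ avoids U A ⟧) +_) (ssum-wsum k U (λ u A → ⟦ F A ∧ lookup A u ⟧)) ⟩
  ssum k (λ A → ⟦ F A ∧ avoids U A ⟧) + wsum U (degree k F) ∎
  where
  open ≤-Reasoning
  pointwise : ∀ A → ⟦ F A ⟧ ≤ ⟦ F A ∧ avoids U A ⟧ + wsum U (λ u → ⟦ F A ∧ lookup A u ⟧)
  pointwise A with F A
  ... | true  = meets-or-avoids U A
  ... | false = z≤n

degree≤star : ∀ k (F : Subset n → Bool) v → degree k F v ≤ star n k
degree≤star k F v =
  ≤-trans (ssum-mono k (λ A _ → ⟦∧⟧≤ʳ (F A) (lookup A v))) (≤-reflexive (ssum-star k v))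

star-bound : ∀ k (F : Subset n → Bool) U →
  ssum k (⟦_⟧ ∘ F) ≤ ssum k (λ A → ⟦ F A ∧ avoids U A ⟧) + ∣ U ∣ * star n k
star-bound {n} k F U = ≤-trans (union-bound k F U) (+-monoʳ-≤ (ssum k (λ A → ⟦ F A ∧ avoids U A ⟧))
  (≤-trans (wsum-mono U (λ u _ → degree≤star k F u)) (≤-reflexive (wsum-const U (star n k)))))

∈⋃ : ∀ (A : Fin t → Subset n) i x → lookup (A i) x ≡ true → lookup (⋃ A) x ≡ true
∈⋃ A i x eq with lookup (⋃ A) x in eq⋃
... | true  = refl
... | false = trans (sym (∉⋃⇒∉ A x eq⋃ i)) eq

∣⋃∣≤* : ∀ r (A : Fin t → Subset n) → (∀ i → ∣ A i ∣ ≡ r) → ∣ ⋃ A ∣ ≤ t * r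
∣⋃∣≤* {t} r A sizes = ≤-trans (∣⋃∣≤ A) (≤-reflexive (trans (sum-cong-≗ sizes) (sum-const t r)))

-- Maximal matchings and vertices of large degree

add-edge : ∀ {s r} {E : Subset n → Bool} ((M , _) : Matching s r E) A → ∣ A ∣ ≡ r → E A ≡ true →
  (∀ i x → lookup (M i) x ≡ true → lookup A x ≡ false) → Matching (suc s) r E
add-edge {n} {s} {r} {E} (M , disj , sizes , mem) A size EA apart =
  M′ , disj′ , (λ { zero → size ; (suc i) → sizes i }) , λ { zero → EA ; (suc i) → mem i }
  where
  M′ : Fin (suc s) → Subset n
  M′ zero    = A
  M′ (suc i) = M i
  disj′ : Disjoint M′
  disj′ zero    zero    x p q = refl
  disj′ zero    (suc j) x p q = contradiction (trans (sym p) (apart j x q)) true≢false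
  disj′ (suc i) zero    x p q = contradiction (trans (sym q) (apart i x p)) true≢false
  disj′ (suc i) (suc j) x p q = cong suc (disj i j x p q)

-- A matching that cannot be extended has a vertex set meeting every edge. The size bound says ∣ U ∣
-- ≤ (s - 1) r without truncated subtraction.
greedy : ∀ s r (E : Subset n → Bool) → Matching s r E ⊎
  ∃ λ U → ∣ U ∣ + r ≤ s * r × ssum r (λ A → ⟦ E A ∧ avoids U A ⟧) ≡ 0
greedy zero    r E = inj₁ ((λ ()) , (λ ()) , (λ ()) , λ ())
greedy (suc s) r E with greedy s r E
... | inj₂ (U , small , cover) = inj₂ (U , ≤-trans small (m≤n+m _ r) , cover)
... | inj₁ matching@(M , disj , sizes , mem) with 0 <? ssum r (λ A → ⟦ E A ∧ avoids (⋃ M) A ⟧)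
...   | no none = inj₂ (⋃ M , ≤-trans (+-monoˡ-≤ r (∣⋃∣≤* r M sizes)) (≤-reflexive (+-comm _ r)) ,
                        n≤0⇒n≡0 (≮⇒≥ none))
...   | yes some =
  let A , size , EA = ssum-member r some
  in inj₁ (add-edge {E = E} matching A size (∧-conicalˡ _ _ EA)
       (λ i x eq → avoids⇒∉ (⋃ M) A (∧-conicalʳ (E A) _ EA) x (∈⋃ M i x eq)))

delete : Fin (suc n) → (Subset (suc n) → Bool) → Subset n → Bool
delete v E B = E (insertAt B v false)

-- Each of the p (k + 1) vertices of the matching lies in at most `star (suc n) k` sets of the link
-- of `v`, so some set of the link misses them all.
add-heavy-vertex : ∀ {p k} (E : Subset (suc n) → Bool) v → p * suc k * star (suc n) k < degree (suc k) E v →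
  Matching p (suc k) (delete v E) → Matching (suc p) (suc k) E
add-heavy-vertex {n} {p} {k} E v heavy (M , disj , sizes , mem) =
  let B , size , q = edge
      linked = ∧-conicalˡ (link E v B) _ q
      v∉B = not-true (∧-conicalʳ (E (B [ v ]≔ true)) _ linked)
      apart : ∀ i x → lookup (M′ i) x ≡ true → lookup (B [ v ]≔ true) x ≡ false
      apart i x eq =
        let y , x≡ , _ = lookup-insertAt (M i) v x eq
        in trans (lookup∘update′ (λ x≡v → punchInᵢ≢i v y (trans (sym x≡) x≡v)) B true)
                 (avoids⇒∉ (⋃ M′) B (∧-conicalʳ (link E v B) _ q) x (∈⋃ M′ i x eq))
  in add-edge {E = E} (M′ , disj′ , sizes′ , mem) (B [ v ]≔ true) (trans (∣[]≔true∣ B v v∉B) (cong suc size))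
       (∧-conicalˡ _ _ linked) apart
  where
  M′ : Fin p → Subset (suc n)
  M′ i = insertAt (M i) v false
  sizes′ : ∀ i → ∣ M′ i ∣ ≡ suc k
  sizes′ i = trans (∣insertAt∣ (M i) v false) (sizes i)
  disj′ : Disjoint M′
  disj′ i j x eq eq′ with lookup-insertAt (M i) v x eq
  ... | y , refl , eqy = disj i j y eqy (trans (sym (insertAt-punchIn (M j) v false y)) eq′)
  edge : ∃ λ B → ∣ B ∣ ≡ k × link E v B ∧ avoids (⋃ M′) B ≡ true
  edge = ssum-member k (+-cancelʳ-< (∣ ⋃ M′ ∣ * star (suc n) k) _ _ (begin-strict
    ∣ ⋃ M′ ∣ * star (suc n) k
      ≤⟨ *-monoˡ-≤ (star (suc n) k) (∣⋃∣≤* (suc k) M′ sizes′) ⟩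
    p * suc k * star (suc n) k
      <⟨ heavy ⟩
    degree (suc k) E v
      ≡⟨ ssum-link k E v ⟨
    ssum k (⟦_⟧ ∘ link E v)
      ≤⟨ star-bound k (link E v) (⋃ M′) ⟩
    ssum k (λ B → ⟦ link E v B ∧ avoids (⋃ M′) B ⟧) + ∣ ⋃ M′ ∣ * star (suc n) k ∎))
    where open ≤-Reasoning

-- Half of 2 p `star n k` pays for removing from each link the sets through the p other vertices;
-- the other half meets the hypothesis of `rainbow`. After the removal, disjoint link sets stay
-- disjoint when their own vertices are added.
heavy-vertices : ∀ {p k} (E : Subset n → Bool) (v : Fin (suc p) → Fin n) → (∀ {i j} → v i ≡ v j → i ≡ j) →
  (∀ i → 2 * p * star n k < degree (suc k) E (v i)) → suc p * k ≤ n → Matching (suc p) (suc k) E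
heavy-vertices {n} {p} {k} E v v-injective heavy fits =
  let B , disj , sizes , mem = rainbow n p (λ _ → k) F (≤-trans (≤-reflexive (sum-const (suc p) k)) fits) big
      linked : ∀ i → link E (v i) (B i) ≡ true
      linked i = ∧-conicalˡ _ _ (mem i)
      v∉B : ∀ i j → lookup (B j) (v i) ≡ false
      v∉B i j = case i ≟ᶠ j of λ
        { (yes refl) → not-true (∧-conicalʳ (E (B j [ v j ]≔ true)) _ (linked j))
        ; (no i≢j)   → avoids⇒∉ (W j) (B j) (∧-conicalʳ (link E (v j) (B j)) _ (mem j)) (v i) (∈W i≢j) }
      ∈A : ∀ i x → lookup (B i [ v i ]≔ true) x ≡ true → x ≡ v i ⊎ lookup (B i) x ≡ true
      ∈A i x eq = case x ≟ᶠ v i of λ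
        { (yes x≡v) → inj₁ x≡v
        ; (no x≢v)  → inj₂ (trans (sym (lookup∘update′ x≢v (B i) true)) eq) }
      disj′ : Disjoint (λ i → B i [ v i ]≔ true)
      disj′ i j x p q = case ∈A i x p , ∈A j x q of λ
        { (inj₁ x≡vi , inj₁ x≡vj) → v-injective (trans (sym x≡vi) x≡vj)
        ; (inj₁ refl , inj₂ x∈Bj) → contradiction (trans (sym x∈Bj) (v∉B i j)) true≢false
        ; (inj₂ x∈Bi , inj₁ refl) → contradiction (trans (sym x∈Bi) (v∉B j i)) true≢false
        ; (inj₂ x∈Bi , inj₂ x∈Bj) → disj i j x x∈Bi x∈Bj }
  in (λ i → B i [ v i ]≔ true) , disj′ ,
     (λ i → trans (∣[]≔true∣ (B i) (v i) (v∉B i i)) (cong suc (sizes i))) ,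
     λ i → ∧-conicalˡ _ _ (linked i)
  where
  others : Fin (suc p) → Fin p → Subset n
  others i j = ⁅ v (punchIn i j) ⁆
  W : Fin (suc p) → Subset n
  W i = ⋃ (others i)
  ∣W∣≤ : ∀ i → ∣ W i ∣ ≤ p
  ∣W∣≤ i = ≤-trans (∣⋃∣≤* 1 (others i) (λ j → ∣⁅x⁆∣≡1 (v (punchIn i j)))) (≤-reflexive (*-identityʳ p))
  ∈W : ∀ {i j} → i ≢ j → lookup (W j) (v i) ≡ true
  ∈W {i} {j} i≢j = ∈⋃ (others j) (punchOut (i≢j ∘ sym)) (v i)
    (trans (cong (λ l → lookup ⁅ v l ⁆ (v i)) (punchIn-punchOut (i≢j ∘ sym))) ([]=⇒lookup (x∈⁅x⁆ (v i))))
  F : Fin (suc p) → Subset n → Bool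
  F i B = link E (v i) B ∧ avoids (W i) B
  big : ∀ i → p * star n k < ssum k (⟦_⟧ ∘ F i)
  big i = +-cancelʳ-< (p * star n k) _ _ (begin-strict
    p * star n k + p * star n k           ≡⟨ double p (star n k) ⟩
    2 * p * star n k                      <⟨ heavy i ⟩
    degree (suc k) E (v i)                ≡⟨ ssum-link k E (v i) ⟨
    ssum k (⟦_⟧ ∘ link E (v i))           ≤⟨ star-bound k (link E (v i)) (W i) ⟩
    ssum k (⟦_⟧ ∘ F i) + ∣ W i ∣ * star n k ≤⟨ +-monoʳ-≤ (ssum k (⟦_⟧ ∘ F i)) (*-monoˡ-≤ (star n k) (∣W∣≤ i)) ⟩
    ssum k (⟦_⟧ ∘ F i) + p * star n k     ∎)
    where
    open ≤-Reasoning
    double : ∀ p y → p * y + p * y ≡ 2 * p * y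
    double = solve-∀

-- Degree sums inside and outside a cover

pick : ∀ t (L : Subset n) → t ≤ ∣ L ∣ →
  ∃ λ (v : Fin t → Fin n) → (∀ {i j} → v i ≡ v j → i ≡ j) × (∀ i → lookup L (v i) ≡ true)
pick zero    L           _        = (λ ()) , (λ { {()} }) , λ ()
pick (suc t) (true ∷ L)  (s≤s le) =
  let v , inj , v∈L = pick t L le
  in (λ { zero → zero ; (suc i) → suc (v i) }) ,
     (λ { {zero} {zero} _ → refl ; {suc i} {suc j} eq → cong suc (inj (suc-injectiveᶠ eq)) }) ,
     λ { zero → refl ; (suc i) → v∈L i }
pick (suc t) (false ∷ L) le       =
  let v , inj , v∈L = pick (suc t) L le in suc ∘ v , inj ∘ suc-injectiveᶠ , v∈L

-- Every point of U is charged b, and the heavy ones a on top; charging b to the heavy ones as well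
-- avoids the difference of ∣ U ∣ and ∣ L ∣.
heavy-part : ∀ (U : Subset n) (d : Fin n → ℕ) a b → (∀ x → d x ≤ a) →
  ∃ λ L → (∀ x → lookup L x ≡ true → b < d x) × wsum U d ≤ ∣ L ∣ * a + ∣ U ∣ * b
heavy-part []          d a b d≤ = [] , (λ ()) , z≤n
heavy-part (false ∷ U) d a b d≤ =
  let L , heavy , bound = heavy-part U (d ∘ suc) a b (d≤ ∘ suc)
  in false ∷ L , (λ { (suc x) → heavy x }) , bound
heavy-part (true ∷ U)  d a b d≤ with heavy-part U (d ∘ suc) a b (d≤ ∘ suc) | b <? d zero
... | L , heavy , bound | yes b<d = true ∷ L , (λ { zero _ → b<d ; (suc x) → heavy x }) ,
  ≤-trans (+-mono-≤ (d≤ zero) bound)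
    (≤-trans (≤-reflexive (sym (+-assoc a _ _))) (+-monoʳ-≤ (a + ∣ L ∣ * a) (m≤n+m _ b)))
... | L , heavy , bound | no b≮d  = false ∷ L , (λ { (suc x) → heavy x }) ,
  ≤-trans (+-mono-≤ (≮⇒≥ b≮d) bound) (≤-reflexive (x∙yz≈y∙xz b (∣ L ∣ * a) _))

split-subset : ∀ r (W : Subset n) → r ≤ ∣ W ∣ → ∃ λ S → ∃ λ T →
  ∣ S ∣ ≡ r × r + ∣ T ∣ ≡ ∣ W ∣ ×
  (∀ x → lookup S x ≡ true → lookup W x ≡ true) × (∀ x → lookup T x ≡ true → lookup W x ≡ true) ×
  (∀ w → wsum S w + wsum T w ≡ wsum W w)
split-subset {n} zero W _ =
  ⊥ , W , ∣⊥∣≡0 n , refl , (λ x eq → contradiction (trans (sym eq) (lookup-replicate x false)) true≢false) , (λ _ eq → eq) ,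
  λ w → cong (_+ wsum W w) (wsum-⊥ w)
  where
  wsum-⊥ : ∀ {n} (w : Fin n → ℕ) → wsum ⊥ w ≡ 0
  wsum-⊥ {zero}  w = refl
  wsum-⊥ {suc n} w = wsum-⊥ (w ∘ suc)
split-subset (suc r) (true ∷ W) (s≤s r≤) =
  let S , T , size , rest , S⊆ , T⊆ , sums = split-subset r W r≤
  in true ∷ S , false ∷ T , cong suc size , cong suc rest ,
     (λ { zero _ → refl ; (suc x) → S⊆ x }) , (λ { (suc x) → T⊆ x }) ,
     λ w → trans (+-assoc (w zero) _ _) (cong (w zero +_) (sums (w ∘ suc)))
split-subset (suc r) (false ∷ W) r≤ =
  let S , T , size , rest , S⊆ , T⊆ , sums = split-subset (suc r) W r≤
  in false ∷ S , false ∷ T , size , rest , (λ { (suc x) → S⊆ x }) , (λ { (suc x) → T⊆ x }) ,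
     λ w → sums (w ∘ suc)

wsum-blocks : ∀ q r b (W : Subset n) w → q * r ≤ ∣ W ∣ →
  (∀ S → ∣ S ∣ ≡ r → (∀ x → lookup S x ≡ true → lookup W x ≡ true) → b ≤ wsum S w) → q * b ≤ wsum W w
wsum-blocks zero    r b W w _    h = z≤n
wsum-blocks (suc q) r b W w fits h =
  let S , T , size , rest , S⊆ , T⊆ , sums = split-subset r W (≤-trans (m≤m+n r (q * r)) fits)
  in ≤-trans (+-mono-≤ (h S size S⊆)
               (wsum-blocks q r b T w (+-cancelˡ-≤ r _ _ (≤-trans fits (≤-reflexive (sym rest))))
                 (λ S′ size′ S′⊆ → h S′ size′ (λ x → T⊆ x ∘ S′⊆ x))))
             (≤-reflexive (sums w))

-- A set that meets U has at most ∣ A ∣ - 1 points outside; the indicator corrects for sets that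
-- miss U.
wsum-∁-members : ∀ (U A : Subset n) → suc (wsum (∁ U) (λ u → ⟦ lookup A u ⟧)) ≤ ∣ A ∣ + ⟦ avoids U A ⟧
wsum-∁-members []          []          = ≤-refl
wsum-∁-members (true ∷ U)  (true ∷ A)  = s≤s (≤-trans (wsum-members (∁ U) A) (m≤m+n _ 0))
  where
  wsum-members : ∀ {n} (V A : Subset n) → wsum V (λ u → ⟦ lookup A u ⟧) ≤ ∣ A ∣
  wsum-members []          []          = z≤n
  wsum-members (true ∷ V)  (true ∷ A)  = s≤s (wsum-members V A)
  wsum-members (true ∷ V)  (false ∷ A) = wsum-members V A
  wsum-members (false ∷ V) (true ∷ A)  = m≤n⇒m≤1+n (wsum-members V A)
  wsum-members (false ∷ V) (false ∷ A) = wsum-members V A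
wsum-∁-members (true ∷ U)  (false ∷ A) = wsum-∁-members U A
wsum-∁-members (false ∷ U) (true ∷ A)  = s≤s (wsum-∁-members U A)
wsum-∁-members (false ∷ U) (false ∷ A) = wsum-∁-members U A

-- Counting incidences by edges: each edge meets the cover, so at most k of its k + 1 points lie
-- outside.
degree-outside-cover : ∀ k (E : Subset n → Bool) U → ssum (suc k) (λ A → ⟦ E A ∧ avoids U A ⟧) ≡ 0 →
  wsum (∁ U) (degree (suc k) E) ≤ k * ssum (suc k) (⟦_⟧ ∘ E)
degree-outside-cover k E U cover = begin
  wsum (∁ U) (degree (suc k) E)
    ≡⟨ ssum-wsum (suc k) (∁ U) (λ u A → ⟦ E A ∧ lookup A u ⟧) ⟨
  ssum (suc k) (λ A → wsum (∁ U) (λ u → ⟦ E A ∧ lookup A u ⟧))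
    ≤⟨ ssum-mono (suc k) pointwise ⟩
  ssum (suc k) (λ A → k * ⟦ E A ⟧ + ⟦ E A ∧ avoids U A ⟧)
    ≡⟨ ssum-+ (suc k) (λ A → k * ⟦ E A ⟧) (λ A → ⟦ E A ∧ avoids U A ⟧) ⟩
  ssum (suc k) (λ A → k * ⟦ E A ⟧) + ssum (suc k) (λ A → ⟦ E A ∧ avoids U A ⟧)
    ≡⟨ cong₂ _+_ (ssum-* (suc k) k (⟦_⟧ ∘ E)) cover ⟩
  k * ssum (suc k) (⟦_⟧ ∘ E) + 0
    ≡⟨ +-identityʳ _ ⟩
  k * ssum (suc k) (⟦_⟧ ∘ E) ∎
  where
  open ≤-Reasoning
  pointwise : ∀ A → ∣ A ∣ ≡ suc k →
    wsum (∁ U) (λ u → ⟦ E A ∧ lookup A u ⟧) ≤ k * ⟦ E A ⟧ + ⟦ E A ∧ avoids U A ⟧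
  pointwise A size with E A
  ... | true  = s≤s⁻¹ (≤-trans (wsum-∁-members U A)
                        (≤-reflexive (cong (_+ ⟦ avoids U A ⟧) (trans size (cong suc (sym (*-identityʳ k)))))))
  ... | false = ≤-trans (≤-reflexive (trans (wsum-const (∁ U) 0) (*-zeroʳ ∣ ∁ U ∣))) z≤n

≤ssum : ∀ (f : Subset n → ℕ) A → f A ≤ ssum ∣ A ∣ f
≤ssum f []         = ≤-refl
≤ssum f (true ∷ A) = ≤-trans (≤ssum (f ∘ (true ∷_)) A) (m≤m+n _ _)
≤ssum f (false ∷ A) with ∣ A ∣ | ≤ssum (f ∘ (false ∷_)) A
... | zero  | le = le
... | suc k | le = ≤-trans le (m≤n+m _ _)

degree-delete : ∀ k (E : Subset (suc n) → Bool) v u →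
  degree (suc k) E (punchIn v u) ≤ degree (suc k) (delete v E) u + star n k
degree-delete {n} k E v u = begin
  degree (suc k) E (punchIn v u)
    ≡⟨ ssum-insertAt k v (λ A → ⟦ E A ∧ lookup A (punchIn v u) ⟧) ⟩
  ssum k (λ B → ⟦ E (insertAt B v true) ∧ lookup (insertAt B v true) (punchIn v u) ⟧) +
    ssum (suc k) (λ B → ⟦ E (insertAt B v false) ∧ lookup (insertAt B v false) (punchIn v u) ⟧)
    ≤⟨ +-mono-≤
         (≤-trans (ssum-mono k (λ B _ → ≤-trans (⟦∧⟧≤ʳ (E (insertAt B v true)) _)
                                                (≤-reflexive (cong ⟦_⟧ (insertAt-punchIn B v true u)))))
                  (≤-reflexive (ssum-star k u)))
         (≤-reflexive (ssum-cong (suc k) (λ B _ → cong (λ b → ⟦ delete v E B ∧ b ⟧) (insertAt-punchIn B v false u)))) ⟩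
  star n k + degree (suc k) (delete v E) u
    ≡⟨ +-comm (star n k) _ ⟩
  degree (suc k) (delete v E) u + star n k ∎
  where open ≤-Reasoning

-- Binomial estimates

C≡star+C : ∀ n k → suc n C k ≡ star (suc n) k + n C k
C≡star+C n zero    = refl
C≡star+C n (suc k) = sym (nCk+nC[k+1]≡[n+1]C[k+1] n k)

C-mono : ∀ m p k → m C k ≤ (m + p) C k
C-mono m zero    k = ≤-reflexive (cong (_C k) (sym (+-identityʳ m)))
C-mono m (suc p) k = begin
  m C k                                ≤⟨ C-mono m p k ⟩
  (m + p) C k                          ≤⟨ m≤n+m _ _ ⟩
  star (suc (m + p)) k + (m + p) C k   ≡⟨ C≡star+C (m + p) k ⟨
  suc (m + p) C k                      ≡⟨ cong (_C k) (+-suc m p) ⟨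
  (m + suc p) C k                      ∎
  where open ≤-Reasoning

-- By Pascal's rule the growth is the sum of i C j over m ≤ i < m + p, and the first term is the
-- smallest. `C-growth-≤` compares with the last term instead.
C-growth-≥ : ∀ m p j → m C suc j + p * (m C j) ≤ (m + p) C suc j
C-growth-≥ m zero    j = ≤-reflexive (trans (+-identityʳ _) (cong (_C suc j) (sym (+-identityʳ m))))
C-growth-≥ m (suc p) j = begin
  m C suc j + (m C j + p * (m C j))    ≡⟨ x∙yz≈y∙xz (m C suc j) (m C j) _ ⟩
  m C j + (m C suc j + p * (m C j))    ≤⟨ +-mono-≤ (C-mono m p j) (C-growth-≥ m p j) ⟩
  (m + p) C j + (m + p) C suc j        ≡⟨ nCk+nC[k+1]≡[n+1]C[k+1] (m + p) j ⟩
  suc (m + p) C suc j                  ≡⟨ cong (_C suc j) (+-suc m p) ⟨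
  (m + suc p) C suc j                  ∎
  where open ≤-Reasoning

C-growth-≤ : ∀ m p j → (m + suc p) C suc j ≤ m C suc j + suc p * ((m + p) C j)
C-growth-≤ m p j = begin
  (m + suc p) C suc j                          ≡⟨ cong (_C suc j) (+-suc m p) ⟩
  suc (m + p) C suc j                          ≡⟨ nCk+nC[k+1]≡[n+1]C[k+1] (m + p) j ⟨
  (m + p) C j + (m + p) C suc j                ≤⟨ +-monoʳ-≤ ((m + p) C j) (rest p) ⟩
  (m + p) C j + (m C suc j + p * ((m + p) C j)) ≡⟨ x∙yz≈y∙xz ((m + p) C j) (m C suc j) _ ⟩
  m C suc j + suc p * ((m + p) C j)            ∎
  where
  open ≤-Reasoning
  rest : ∀ p → (m + p) C suc j ≤ m C suc j + p * ((m + p) C j)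
  rest zero    = ≤-reflexive (trans (cong (_C suc j) (+-identityʳ m)) (sym (+-identityʳ _)))
  rest (suc p) = ≤-trans (C-growth-≤ m p j) (+-monoʳ-≤ (m C suc j) (*-monoʳ-≤ (suc p)
    (≤-trans (C-mono (m + p) 1 j) (≤-reflexive (cong (_C j) (trans (+-comm (m + p) 1) (sym (+-suc m p))))))))

-- Pairs of a point and a (j + 1)-set containing it, counted by points and by sets.
C-absorption : ∀ n j → suc n * (n C j) ≡ suc j * (suc n C suc j)
C-absorption n j = begin
  suc n * (n C j)
    ≡⟨ cong (_* (n C j)) (∣⊤∣≡n (suc n)) ⟨
  ∣ ⊤ {suc n} ∣ * (n C j)
    ≡⟨ wsum-const (⊤ {suc n}) (n C j) ⟨
  wsum (⊤ {suc n}) (λ _ → n C j)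
    ≡⟨ wsum-cong (⊤ {suc n}) (λ v → sym (ssum-star (suc j) v)) ⟩
  wsum (⊤ {suc n}) (λ v → ssum (suc j) (λ A → ⟦ lookup A v ⟧))
    ≡⟨ ssum-wsum (suc j) (⊤ {suc n}) (λ v A → ⟦ lookup A v ⟧) ⟨
  ssum (suc j) (λ A → wsum (⊤ {suc n}) (λ v → ⟦ lookup A v ⟧))
    ≡⟨ ssum-cong {n = suc n} (suc j) (λ A size → trans (wsum-⊤ A) (trans size (sym (*-identityʳ (suc j))))) ⟩
  ssum {suc n} (suc j) (λ _ → suc j * 1)
    ≡⟨ ssum-* {suc n} (suc j) (suc j) (λ _ → 1) ⟩
  suc j * ssum {suc n} (suc j) (λ _ → 1)
    ≡⟨ cong (suc j *_) (ssum-one (suc n) (suc j)) ⟩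
  suc j * (suc n C suc j) ∎
  where
  open ≡-Reasoning
  wsum-⊤ : ∀ {n} (A : Subset n) → wsum ⊤ (λ v → ⟦ lookup A v ⟧) ≡ ∣ A ∣
  wsum-⊤ []      = refl
  wsum-⊤ (a ∷ A) = trans (cong (⟦ a ⟧ +_) (wsum-⊤ A)) (sym (∣∷∣ a A))

-- With r = j + 2, the hypothesis is 3 r² (p + 1) ≤ N + 1, `r ^ 2` being unfolded. Growth and
-- absorption give N Y ≤ N Z + (p + 1) j Y, so Z is at least the fraction 1 - (p + 1) j / N of Y.
-- The loss is affordable because c (p + 1) j ≤ 2 N; the term c (p + 1) j Y is added to both sides
-- to avoid subtraction.
binomial-ratio : ∀ j m p → 3 * (suc (suc j) * (suc (suc j) * 1)) * suc p ≤ suc (suc (m + p)) →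
  3 * suc j * ((m + suc p) C j) ≤ (3 * suc j + 2) * (m C j)
binomial-ratio zero    m p large = s≤s (s≤s (s≤s z≤n))
binomial-ratio (suc i) m p large = *-cancelˡ-≤ N (+-cancelʳ-≤ (c * (suc p * (j * Y))) _ _ (begin
  N * (3 * suc j * Y) + c * (suc p * (j * Y))      ≡⟨ regroup₁ N j Y c (suc p) ⟩
  (N * (3 * suc j) + c * suc p * j) * Y            ≤⟨ *-monoˡ-≤ Y (+-monoʳ-≤ (N * (3 * suc j)) cpj≤2N) ⟩
  (N * (3 * suc j) + 2 * N) * Y                    ≡⟨ regroup₂ N j Y ⟩
  c * (N * Y)                                      ≤⟨ *-monoʳ-≤ c NY≤ ⟩
  c * (N * Z + suc p * (j * Y))                    ≡⟨ regroup₃ c N Z (suc p * (j * Y)) ⟩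
  N * (c * Z) + c * (suc p * (j * Y))              ∎))
  where
  open ≤-Reasoning
  j = suc i
  N = suc (m + p)
  c = 3 * suc j + 2
  Y = (m + suc p) C j
  Z = m C j
  regroup₁ : ∀ N j Y c p → N * (3 * suc j * Y) + c * (p * (j * Y)) ≡ (N * (3 * suc j) + c * p * j) * Y
  regroup₁ = solve-∀
  regroup₂ : ∀ N j Y → (N * (3 * suc j) + 2 * N) * Y ≡ (3 * suc j + 2) * (N * Y)
  regroup₂ = solve-∀
  regroup₃ : ∀ c N Z X → c * (N * Z + X) ≡ N * (c * Z) + c * X
  regroup₃ = solve-∀
  -- The last bracket is the remainder, a polynomial with nonnegative coefficients; the leading 2
  -- matches 2 (N + 1) = 2 + 2 N.
  slack : ∀ j p → 2 * (3 * (suc (suc j) * (suc (suc j) * 1)) * suc p) ≡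
    (2 + (3 * suc j + 2) * suc p * j) + (3 * j * j * suc p + 19 * j * suc p + 24 * p + 22)
  slack = solve-∀
  double-suc : ∀ N → 2 * suc N ≡ 2 + 2 * N
  double-suc = solve-∀
  cpj≤2N : c * suc p * j ≤ 2 * N
  cpj≤2N = +-cancelˡ-≤ 2 _ _ (begin
    2 + c * suc p * j                                     ≤⟨ m≤m+n _ _ ⟩
    (2 + c * suc p * j) + (3 * j * j * suc p + 19 * j * suc p + 24 * p + 22) ≡⟨ slack j p ⟨
    2 * (3 * (suc (suc j) * (suc (suc j) * 1)) * suc p)   ≤⟨ *-monoʳ-≤ 2 large ⟩
    2 * suc N                                             ≡⟨ double-suc N ⟩
    2 + 2 * N                                             ∎)
  NY≤ : N * Y ≤ N * Z + suc p * (j * Y)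
  NY≤ = begin
    N * Y                                         ≤⟨ *-monoʳ-≤ N (C-growth-≤ m p i) ⟩
    N * (Z + suc p * ((m + p) C i))               ≡⟨ regroup N Z (suc p) ((m + p) C i) ⟩
    N * Z + suc p * (N * ((m + p) C i))           ≡⟨ cong (λ x → N * Z + suc p * x) (C-absorption (m + p) i) ⟩
    N * Z + suc p * (j * (suc (m + p) C j))       ≡⟨ cong (λ x → N * Z + suc p * (j * (x C j))) (+-suc m p) ⟨
    N * Z + suc p * (j * Y)                       ∎
    where
    regroup : ∀ N Z p x → N * (Z + p * x) ≡ N * Z + p * (N * x)
    regroup = solve-∀

-- With M = N - (p + 1), the difference of binomials is at least (p + 1) C(M, k-1), and
-- `binomial-ratio` compares C(M, k-1) with C(N, k-1).
threshold-bound : ∀ k N p → 3 * (suc k * (suc k * 1)) * suc p ≤ suc N →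
  3 * k * (suc p * star (suc N) k) ≤ (3 * k + 2) * (N C k ∸ (N ∸ suc p) C k)
threshold-bound zero    N p large = z≤n
threshold-bound (suc j) N p large = begin
  3 * suc j * (suc p * (N C j))              ≡⟨ *-x∙yz≈y∙xz (3 * suc j) (suc p) (N C j) ⟩
  suc p * (3 * suc j * (N C j))              ≡⟨ cong (λ x → suc p * (3 * suc j * (x C j))) N≡ ⟨
  suc p * (3 * suc j * ((M + suc p) C j))    ≤⟨ *-monoʳ-≤ (suc p) (binomial-ratio j M p large′) ⟩
  suc p * ((3 * suc j + 2) * (M C j))        ≡⟨ *-x∙yz≈y∙xz (suc p) (3 * suc j + 2) (M C j) ⟩
  (3 * suc j + 2) * (suc p * (M C j))        ≤⟨ *-monoʳ-≤ (3 * suc j + 2) (m+n≤o⇒n≤o∸m (M C suc j)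
                                                  (≤-trans (C-growth-≥ M (suc p) j) (≤-reflexive (cong (_C suc j) N≡)))) ⟩
  (3 * suc j + 2) * (N C suc j ∸ M C suc j)  ∎
  where
  open ≤-Reasoning
  M = N ∸ suc p
  expand : ∀ j p → 3 * (suc (suc j) * (suc (suc j) * 1)) * suc p ≡
    suc (suc p) + (3 * j * j * suc p + 12 * j * suc p + 11 * p + 10)
  expand = solve-∀
  p≤N : suc p ≤ N
  p≤N = s≤s⁻¹ (≤-trans (≤-trans (m≤m+n _ _) (≤-reflexive (sym (expand j p)))) large)
  N≡ : M + suc p ≡ N
  N≡ = m∸n+n≡m p≤N
  large′ : 3 * (suc (suc j) * (suc (suc j) * 1)) * suc p ≤ suc (suc (M + p))
  large′ = ≤-trans large (s≤s (≤-reflexive (trans (sym N≡) (+-suc M p))))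
  m+n≤o⇒n≤o∸m : ∀ a {b c} → a + b ≤ c → b ≤ c ∸ a
  m+n≤o⇒n≤o∸m a {b} le = m+n≤o⇒m≤o∸n b (≤-trans (≤-reflexive (+-comm b a)) le)

-- The Ore-degree condition for matchings of size p + 1 in (k + 1)-uniform families on Fin (N + 1)

threshold : ℕ → ℕ → ℕ → ℕ
threshold N k p = suc k * (N C k ∸ (N ∸ p) C k)

Ore : ℕ → ℕ → (Subset n → Bool) → Set
Ore r b E = ∀ S → ∣ S ∣ ≡ r → E S ≡ false → b < wsum S (degree r E)

-- The subtracted binomial is the same before and after, so the threshold drops by exactly (k + 1)
-- `star (suc n) k`. A (k + 1)-set loses at most this much, since each of its points loses only the
-- edges shared with `v`.
Ore-delete : ∀ k p (E : Subset (suc (suc n)) → Bool) v → Ore (suc k) (threshold (suc n) k (suc p)) E →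
  Ore (suc k) (threshold n k p) (delete v E)
Ore-delete {n} k p E v ore S size ES = +-cancelʳ-< (suc k * star (suc n) k) _ _ (begin-strict
  suc k * (n C k ∸ (n ∸ p) C k) + suc k * star (suc n) k
    ≡⟨ *-distribˡ-+ (suc k) (n C k ∸ (n ∸ p) C k) (star (suc n) k) ⟨
  suc k * (n C k ∸ (n ∸ p) C k + star (suc n) k)
    ≡⟨ cong (suc k *_) (trans (+-comm _ (star (suc n) k)) (sym (+-∸-assoc (star (suc n) k) C≤C))) ⟩
  suc k * (star (suc n) k + n C k ∸ (n ∸ p) C k)
    ≡⟨ cong (λ x → suc k * (x ∸ (n ∸ p) C k)) (C≡star+C n k) ⟨
  suc k * (suc n C k ∸ (n ∸ p) C k)
    <⟨ ore (insertAt S v false) (trans (∣insertAt∣ S v false) size) ES ⟩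
  wsum (insertAt S v false) (degree (suc k) E)
    ≡⟨ wsum-insertAt S v (degree (suc k) E) ⟩
  wsum S (degree (suc k) E ∘ punchIn v)
    ≤⟨ wsum-mono S (λ u _ → degree-delete k E v u) ⟩
  wsum S (λ u → degree (suc k) (delete v E) u + star (suc n) k)
    ≡⟨ wsum-+ S (degree (suc k) (delete v E)) (λ _ → star (suc n) k) ⟩
  wsum S (degree (suc k) (delete v E)) + wsum S (λ _ → star (suc n) k)
    ≡⟨ cong (wsum S (degree (suc k) (delete v E)) +_)
            (trans (wsum-const S (star (suc n) k)) (cong (_* star (suc n) k) size)) ⟩
  wsum S (degree (suc k) (delete v E)) + suc k * star (suc n) k ∎)
  where
  open ≤-Reasoning
  C≤C : (n ∸ p) C k ≤ n C k
  C≤C = ≤-trans (C-mono (n ∸ p) (n ∸ (n ∸ p)) k) (≤-reflexive (cong (_C k) (m+[n∸m]≡n (m∸n≤m n p))))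

light-cover-impossible : ∀ {n} k p (E : Subset (suc n) → Bool) U ℓ → let Y = star (suc n) k in
  3 * (suc k * (suc k * 1)) * suc p ≤ suc n → Ore (suc k) (threshold n k (suc p)) E →
  ∣ U ∣ ≤ suc p * suc k → ssum (suc k) (λ A → ⟦ E A ∧ avoids U A ⟧) ≡ 0 → ℓ ≤ suc p →
  ¬ (wsum U (degree (suc k) E) ≤ ℓ * (suc p * suc k * Y) + ∣ U ∣ * (2 * suc p * Y))
light-cover-impossible {n} k p′ E U ℓ large ore small cover ℓ≤p light =
  contradiction lower (<⇒≱ (begin-strict
    wsum (∁ U) (degree r E)
      ≤⟨ degree-outside-cover k E U cover ⟩
    k * ssum r (⟦_⟧ ∘ E)
      ≤⟨ *-monoʳ-≤ k edges≤ ⟩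
    k * (p * (p * r * Y) + p * r * (2 * p * Y))
      ≡⟨ regroup k p r Y ⟩
    p * r * (3 * k * (p * Y))
      ≤⟨ *-monoʳ-≤ (p * r) (threshold-bound k n p′ large) ⟩
    p * r * ((3 * k + 2) * (n C k ∸ (n ∸ p) C k))
      ≡⟨ regroup′ p r (3 * k + 2) (n C k ∸ (n ∸ p) C k) ⟩
    q * threshold n k p
      <⟨ *-monoʳ-< q (n<1+n (threshold n k p)) ⟩
    q * suc (threshold n k p) ∎))
  where
  open ≤-Reasoning
  p = suc p′
  r = suc k
  Y = star (suc n) k
  -- The number of disjoint r-sets outside U: q r + p r = 3 r² p.
  q = p * (3 * k + 2)
  instance
    q≢0 : NonZero q
    q≢0 = m*n≢0 p (3 * k + 2) {{_}} {{≢-nonZero (λ eq → 1+n≢0 (trans (+-comm 2 (3 * k)) eq))}}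
  regroup : ∀ k p r Y → k * (p * (p * r * Y) + p * r * (2 * p * Y)) ≡ p * r * (3 * k * (p * Y))
  regroup = solve-∀
  regroup′ : ∀ p r c d → p * r * (c * d) ≡ p * c * (r * d)
  regroup′ = solve-∀
  edges≤ : ssum r (⟦_⟧ ∘ E) ≤ p * (p * r * Y) + p * r * (2 * p * Y)
  edges≤ = begin
    ssum r (⟦_⟧ ∘ E)
      ≤⟨ union-bound r E U ⟩
    ssum r (λ A → ⟦ E A ∧ avoids U A ⟧) + wsum U (degree r E)
      ≡⟨ cong (_+ wsum U (degree r E)) cover ⟩
    wsum U (degree r E)
      ≤⟨ light ⟩
    ℓ * (p * r * Y) + ∣ U ∣ * (2 * p * Y)
      ≤⟨ +-mono-≤ (*-monoˡ-≤ (p * r * Y) ℓ≤p) (*-monoˡ-≤ (2 * p * Y) small) ⟩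
    p * (p * r * Y) + p * r * (2 * p * Y) ∎
  room : q * r ≤ ∣ ∁ U ∣
  room = begin
    q * r                                     ≤⟨ m+n≤o⇒m≤o∸n (q * r) (≤-trans (≤-reflexive (total k p)) large) ⟩
    suc n ∸ p * r                             ≤⟨ ∸-monoʳ-≤ (suc n) small ⟩
    suc n ∸ ∣ U ∣                             ≡⟨ ∣∁p∣≡n∸∣p∣ U ⟨
    ∣ ∁ U ∣                                   ∎
    where
    total : ∀ k p → p * (3 * k + 2) * suc k + p * suc k ≡ 3 * (suc k * (suc k * 1)) * p
    total = solve-∀
  lower : q * suc (threshold n k p) ≤ wsum (∁ U) (degree r E)
  lower = wsum-blocks q r (suc (threshold n k p)) (∁ U) (degree r E) room
    (λ S size S⊆ → ore S size (nonedge S size (⊆∁⇒avoids U S S⊆)))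
    where
    nonedge : ∀ S → ∣ S ∣ ≡ r → avoids U S ≡ true → E S ≡ false
    nonedge S size avoid with E S in eq
    ... | false = refl
    ... | true  = contradiction
      (≤-trans (≤-reflexive (sym (true⇒⟦⟧≡1 (∧-intro eq avoid))))
        (≤-trans (≤ssum (λ A → ⟦ E A ∧ avoids U A ⟧) S)
          (≤-reflexive (trans (cong (λ x → ssum x (λ A → ⟦ E A ∧ avoids U A ⟧)) size) cover))))
      λ ()

-- Induction on p. The size condition is void at p = 0, so `suc k ≤ suc n` is carried along: it
-- provides a (k + 1)-set, whose degree sum 0 would violate the Ore condition if there were no edge.
ore-matching : ∀ p n k (E : Subset (suc n) → Bool) →
  3 * (suc k * (suc k * 1)) * p ≤ suc n → suc k ≤ suc n → Ore (suc k) (threshold n k p) E →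
  Matching (suc p) (suc k) E
ore-matching zero n k E _ k≤n ore with 0 <? ssum (suc k) (⟦_⟧ ∘ E)
... | yes some =
  let A , size , EA = ssum-member (suc k) {E} some
  in (λ _ → A) , (λ { zero zero _ _ _ → refl }) , (λ _ → size) , λ _ → EA
... | no none = contradiction degrees-vanish (>⇒≢ (≤-<-trans z≤n (ore S size nonedge)))
  where
  no-edges : ssum (suc k) (⟦_⟧ ∘ E) ≡ 0
  no-edges = n≤0⇒n≡0 (≮⇒≥ none)
  sub = split-subset (suc k) ⊤ (≤-trans k≤n (≤-reflexive (sym (∣⊤∣≡n (suc n)))))
  S = proj₁ sub
  size : ∣ S ∣ ≡ suc k
  size = proj₁ (proj₂ (proj₂ sub))
  nonedge : E S ≡ false
  nonedge with E S in eq
  ... | false = refl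
  ... | true  = contradiction
    (≤-trans (≤-reflexive (sym (true⇒⟦⟧≡1 eq)))
      (≤-trans (≤ssum (⟦_⟧ ∘ E) S) (≤-reflexive (trans (cong (λ x → ssum x (⟦_⟧ ∘ E)) size) no-edges))))
    λ ()
  degrees-vanish : wsum S (degree (suc k) E) ≡ 0
  degrees-vanish = n≤0⇒n≡0 (≤-trans
    (wsum-mono S (λ v _ → ≤-trans (ssum-mono (suc k) (λ A _ → ⟦∧⟧≤ˡ (E A) (lookup A v))) (≤-reflexive no-edges)))
    (≤-reflexive (trans (wsum-const S 0) (*-zeroʳ ∣ S ∣))))
ore-matching (suc p) n k E large k≤n ore
  with any? (λ v → suc p * suc k * star (suc n) k <? degree (suc k) E v)
ore-matching (suc p) zero k E large k≤n ore | yes _ = contradiction (≤-trans (≤-reflexive (sym (expand k p))) large) λ { (s≤s ()) }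
  where
  expand : ∀ k p → 3 * (suc k * (suc k * 1)) * suc p ≡
    2 + (3 * k * k * suc p + 6 * k * suc p + 3 * p + 1)
  expand = solve-∀
ore-matching (suc p) (suc n) k E large k≤n ore | yes (v , heavy) =
  -- From p + 1 to p the required number of vertices falls by 3 (k + 1)², more than the one vertex
  -- deleted.
  add-heavy-vertex E v heavy (ore-matching p n k (delete v E)
    (≤-trans (m≤m+n _ _) (s≤s⁻¹ (≤-trans (≤-reflexive (sym (expand₁ k p))) large)))
    (≤-trans (m≤m+n _ _) (s≤s⁻¹ (≤-trans (≤-reflexive (sym (expand₂ k p))) large)))
    (Ore-delete k p E v ore))
  where
  expand₁ : ∀ k p → 3 * (suc k * (suc k * 1)) * suc p ≡ suc (3 * (suc k * (suc k * 1)) * p + (3 * k * k + 6 * k + 2))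
  expand₁ = solve-∀
  expand₂ : ∀ k p → 3 * (suc k * (suc k * 1)) * suc p ≡
    suc (suc k + (3 * k * k * suc p + 6 * k * p + 5 * k + 3 * p + 1))
  expand₂ = solve-∀
ore-matching (suc p) n k E large k≤n ore | no light with greedy (suc (suc p)) (suc k) E
... | inj₁ matching = matching
... | inj₂ (U , small , cover)
  with heavy-part U (degree (suc k) E) (suc p * suc k * star (suc n) k) (2 * suc p * star (suc n) k)
         (λ v → ≮⇒≥ (λ lt → light (v , lt)))
... | L , heavy , bound with suc (suc p) ≤? ∣ L ∣
...   | yes many =
  let v , v-injective , v∈L = pick (suc (suc p)) L many
  in heavy-vertices E v v-injective (λ i → heavy (v i) (v∈L i))
       (≤-trans (≤-trans (m≤m+n _ _) (≤-reflexive (sym (expand k p)))) large)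
  where
  expand : ∀ k p → 3 * (suc k * (suc k * 1)) * suc p ≡
    suc (suc p) * k + (3 * k * k * suc p + 4 * k + 5 * k * p + 3 * suc p)
  expand = solve-∀
...   | no few = ⊥-elim (light-cover-impossible k p E U ∣ L ∣ large ore
    (+-cancelʳ-≤ (suc k) _ _ (≤-trans small (≤-reflexive (+-comm (suc k) _)))) cover (s≤s⁻¹ (≰⇒> few)) bound)

-- From lists of edges to Boolean-valued families

_≟ˢ_ : (A B : Subset n) → Dec (A ≡ B)
_≟ˢ_ = ≡-dec _≟ᵇ_

_∈ₗ?_ : (A : Subset n) (es : List (Subset n)) → Dec (A ∈ₗ es)
_∈ₗ?_ = DecMembership._∈?_ _≟ˢ_

isEdge : List (Subset n) → Subset n → Bool
isEdge es A = Dec.does (A ∈ₗ? es)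

-- Since the head differs from all later edges, its indicator and that of the tail are never both 1,
-- so they add up within the indicator of the whole list. This direction carries the Ore condition
-- from lists to predicates.
length-filter≤degree : ∀ r (es : List (Subset n)) v → All (λ e → ∣ e ∣ ≡ r) es → Unique es →
  length (filter (v ∈?_) es) ≤ degree r (isEdge es) v
length-filter≤degree r []       v _            _               = z≤n
length-filter≤degree r (e ∷ es) v (size ∷ all) (e∉es ∷ unique) = begin
  length (filter (v ∈?_) (e ∷ es))
    ≤⟨ count-head ⟩
  ⟦ lookup e v ⟧ + length (filter (v ∈?_) es)
    ≤⟨ +-mono-≤ point (length-filter≤degree r es v all unique) ⟩
  ssum r (λ A → ⟦ Dec.does (A ≟ˢ e) ∧ lookup A v ⟧) + degree r (isEdge es) v
    ≡⟨ ssum-+ r (λ A → ⟦ Dec.does (A ≟ˢ e) ∧ lookup A v ⟧) (λ A → ⟦ isEdge es A ∧ lookup A v ⟧) ⟨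
  ssum r (λ A → ⟦ Dec.does (A ≟ˢ e) ∧ lookup A v ⟧ + ⟦ isEdge es A ∧ lookup A v ⟧)
    ≤⟨ ssum-mono r (λ A _ → pointwise A) ⟩
  degree r (isEdge (e ∷ es)) v ∎
  where
  open ≤-Reasoning
  count-head : length (filter (v ∈?_) (e ∷ es)) ≤ ⟦ lookup e v ⟧ + length (filter (v ∈?_) es)
  count-head with v ∈? e
  ... | yes v∈e = ≤-reflexive (cong (_+ length (filter (v ∈?_) es)) (sym (true⇒⟦⟧≡1 ([]=⇒lookup v∈e))))
  ... | no  _   = m≤n+m _ _
  at-e : ⟦ lookup e v ⟧ ≤ ⟦ Dec.does (e ≟ˢ e) ∧ lookup e v ⟧
  at-e with e ≟ˢ e
  ... | yes _  = ≤-refl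
  ... | no e≢e = contradiction refl e≢e
  point : ⟦ lookup e v ⟧ ≤ ssum r (λ A → ⟦ Dec.does (A ≟ˢ e) ∧ lookup A v ⟧)
  point = ≤-trans at-e (subst (λ s → ⟦ Dec.does (e ≟ˢ e) ∧ lookup e v ⟧ ≤ ssum s (λ A → ⟦ Dec.does (A ≟ˢ e) ∧ lookup A v ⟧))
                              size (≤ssum (λ A → ⟦ Dec.does (A ≟ˢ e) ∧ lookup A v ⟧) e))
  pointwise : ∀ A → ⟦ Dec.does (A ≟ˢ e) ∧ lookup A v ⟧ + ⟦ isEdge es A ∧ lookup A v ⟧ ≤
                    ⟦ isEdge (e ∷ es) A ∧ lookup A v ⟧
  pointwise A with A ≟ˢ e | A ∈ₗ? es | A ∈ₗ? (e ∷ es)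
  ... | yes refl | yes A∈es | _      = contradiction refl (All.lookup e∉es A∈es)
  ... | yes _    | no _     | yes _  = ≤-reflexive (+-identityʳ _)
  ... | yes A≡e  | no _     | no A∉  = contradiction (here A≡e) A∉
  ... | no _     | yes _    | yes _  = ≤-refl
  ... | no _     | yes A∈es | no A∉  = contradiction (there A∈es) A∉
  ... | no _     | no _     | _      = z≤n

filter-suc : ∀ b (S : Subset n) (f : Fin (suc n) → ℕ) xs →
  sumₗ (map f (filter (_∈? (b ∷ S)) (map suc xs))) ≡ sumₗ (map (f ∘ suc) (filter (_∈? S) xs))
filter-suc b S f []       = refl
filter-suc b S f (x ∷ xs) with x ∈? S
... | yes _ = cong (f (suc x) +_) (filter-suc b S f xs)
... | no  _ = filter-suc b S f xs

sum-filter : ∀ (S : Subset n) (f : Fin n → ℕ) → sumₗ (map f (filter (_∈? S) (allFin n))) ≡ wsum S f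
sum-filter []          f = refl
sum-filter {suc n} (true ∷ S) f = cong (f zero +_) (trans
  (cong (λ xs → sumₗ (map f (filter (_∈? (true ∷ S)) xs))) (sym (map-tabulate (λ i → i) suc)))
  (trans (filter-suc true S f (allFin n)) (sum-filter S (f ∘ suc))))
sum-filter {suc n} (false ∷ S) f = trans
  (cong (λ xs → sumₗ (map f (filter (_∈? (false ∷ S)) xs))) (sym (map-tabulate (λ i → i) suc)))
  (trans (filter-suc false S f (allFin n)) (sum-filter S (f ∘ suc)))

degSet≤wsum : ∀ {r} (H : Hypergraph n r) S → degSet H S ≤ wsum S (degree r (isEdge (edges H)))
degSet≤wsum {r = r} H S = ≤-trans (≤-reflexive (sum-filter S (deg H)))
  (wsum-mono S (λ v _ → length-filter≤degree r (edges H) v (uniform H) (distinct H)))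

∩≡⊥ : ∀ (A B : Subset n) → (∀ x → lookup A x ≡ true → lookup B x ≢ true) → A ∩ B ≡ ⊥
∩≡⊥ []          []          h = refl
∩≡⊥ (true ∷ A)  (true ∷ B)  h = contradiction refl (h zero refl)
∩≡⊥ (true ∷ A)  (false ∷ B) h = cong (false ∷_) (∩≡⊥ A B (h ∘ suc))
∩≡⊥ (false ∷ A) (b ∷ B)     h = cong (false ∷_) (∩≡⊥ A B (h ∘ suc))

matching⇒HasMatching : ∀ {r s} (H : Hypergraph n r) → Matching s r (isEdge (edges H)) → HasMatching H s
matching⇒HasMatching H (M , disj , _ , mem) =
  List.tabulate M , length-tabulate M , All.tabulate⁺ (λ i → edge (M i) (mem i)) ,
  AllPairs.tabulate⁺ (λ {i} {j} i≢j → ∩≡⊥ (M i) (M j) (λ x p q → i≢j (disj i j x p q)))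
  where
  edge : ∀ A → isEdge (edges H) A ≡ true → A ∈ₗ edges H
  edge A eq with A ∈ₗ? edges H
  ... | yes A∈ = A∈

theorem1p6 : (s r n : ℕ) → 2 ≤ s → 1 ≤ r → 3 * (r ^ 2) * (s ∸ 1) ≤ n →
    (H : Hypergraph n r) →
    OreDegreeGreaterThan H (r * (((n ∸ 1) C (r ∸ 1)) ∸ ((n ∸ s) C (r ∸ 1)))) →
    HasMatching H s
theorem1p6 (suc (suc p)) (suc k) zero    (s≤s (s≤s _)) (s≤s _) () H ore
theorem1p6 (suc (suc p)) (suc k) (suc n) (s≤s (s≤s _)) (s≤s _) large H ore =
  matching⇒HasMatching H (ore-matching (suc p) n k (isEdge (edges H)) large
    (≤-trans (≤-trans (m≤m+n _ _) (≤-reflexive (sym (expand k p)))) large) ore′)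
  where
  expand : ∀ k p → 3 * (suc k * (suc k * 1)) * suc p ≡ suc k + (3 * k * k * suc p + 6 * k * p + 5 * k + 3 * p + 2)
  expand = solve-∀
  ore′ : Ore (suc k) (threshold n k (suc p)) (isEdge (edges H))
  ore′ S size eq = <-≤-trans (ore S size nonedge) (degSet≤wsum H S)
    where
    nonedge : ¬ (S ∈ₗ edges H)
    nonedge S∈ with S ∈ₗ? edges H
    ... | no S∉ = S∉ S∈
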